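{- Let $q$ be a prime power and let $k\ge 2$, $n\ge1$ be integers. The following are equivalent: (i) there exists $x\in\mathbb F_{q^n}$ such that $\Delta(x,x^q,x^{q^2},\dots,x^{q^{k-1}})\ne 0$ and $\Delta_1(x,x^q,x^{q^2},\dots,x^{q^{k-1}})=0$; (ii) $X^n-1$ has a factor in $\mathbb F_q[X]$ of the form $X^k+a_{k-1}X^{k-1}+\cdots+a_2X^2+a_0$ (a monic polynomial of degree $k$ whose coefficient of $X$ is $0$).
   Context: $\Delta(X_1,\dots,X_k)=\det\bigl(X_j^{q^i}\bigr)_{0\le i\le k-1,\,1\le j\le k}$ is the Moore determinant over $\mathbb F_q$, and $\Delta_1(X_1,\dots,X_k)$ is the $k\times k$ determinant with rows $(X_1^{q^i},\dots,X_k^{q^i})$ for $i\in\{0,2,3,\dots,k\}$. -}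

module Defs where

open import Level using (Level)
open import Algebra.Bundles using (CommutativeRing)
open import Data.Nat as ℕ using (ℕ; zero; suc; _∸_)
open import Data.Fin as Fin using (Fin; zero; suc; toℕ; punchIn)
open import Data.List using (List; []; _∷_)
open import Data.Product using (Σ; ∃; _×_)
open import Relation.Nullary using (¬_)
open import Relation.Binary.PropositionalEquality using (_≡_)

module _ {c ℓ : Level} (R : CommutativeRing c ℓ) where
  open CommutativeRing R using (Carrier; _≈_; _+_; _*_; -_; 0#; 1#)

  pow : Carrier → ℕ → Carrier
  pow x zero    = 1#
  pow x (suc m) = x * pow x m

  signed : ℕ → Carrier → Carrier
  signed zero    x = x
  signed (suc m) x = - signed m x

  sumFin : ∀ n → (Fin n → Carrier) → Carrier
  sumFin zero    f = 0#
  sumFin (suc n) f = f zero + sumFin n (λ j → f (suc j))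

  sumUpTo : ℕ → (ℕ → Carrier) → Carrier
  sumUpTo zero    f = f zero
  sumUpTo (suc m) f = sumUpTo m f + f (suc m)

  det : ∀ n → (Fin n → Fin n → Carrier) → Carrier
  det zero    M = 1#
  det (suc n) M =
    sumFin (suc n) (λ j → signed (toℕ j)
      (M zero j * det n (λ r c → M (suc r) (punchIn j c))))

  record IsField : Set (c Level.⊔ ℓ) where
    field
      0≉1     : ¬ (0# ≈ 1#)
      inverse : ∀ x → ¬ (x ≈ 0#) → ∃ λ y → (x * y) ≈ 1#

  record HasCard (m : ℕ) : Set (c Level.⊔ ℓ) where
    field
      enum       : Fin m → Carrier
      enum-inj   : ∀ i j → enum i ≈ enum j → i ≡ j
      enum-surj  : ∀ x → ∃ λ i → enum i ≈ x
  -- polynomials given by coefficient functions ℕ → Carrier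
  coeffList : List Carrier → ℕ → Carrier
  coeffList []       _       = 0#
  coeffList (a ∷ as) zero    = a
  coeffList (a ∷ as) (suc i) = coeffList as i

  mulCoeff : (ℕ → Carrier) → (ℕ → Carrier) → ℕ → Carrier
  mulCoeff f g m = sumUpTo m (λ i → f i * g (m ∸ i))

  xn-1 : ℕ → ℕ → Carrier
  xn-1 n i with i ℕ.≟ 0 | i ℕ.≟ n
  ... | _ | Relation.Nullary.yes _ = 1#
  ... | Relation.Nullary.yes _ | Relation.Nullary.no _ = - 1#
  ... | Relation.Nullary.no _ | Relation.Nullary.no _ = 0#

  monicCoeff : ∀ k → (Fin k → Carrier) → ℕ → Carrier
  monicCoeff k a i with i ℕ.<? k | i ℕ.≟ k
  ... | Relation.Nullary.yes i<k | _ = a (Fin.fromℕ< i<k)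
  ... | Relation.Nullary.no _ | Relation.Nullary.yes _ = 1#
  ... | Relation.Nullary.no _ | Relation.Nullary.no _ = 0#

  moore : (q k : ℕ) → (Fin k → Carrier) → Carrier
  moore q k X = det k (λ i j → pow (X j) (q ℕ.^ toℕ i))

  rowExp₁ : ∀ {k} → Fin k → ℕ
  rowExp₁ zero    = 0
  rowExp₁ (suc r) = suc (suc (toℕ r))

  moore₁ : (q k : ℕ) → (Fin k → Carrier) → Carrier
  moore₁ q k X = det k (λ i j → pow (X j) (q ℕ.^ rowExp₁ i))

  conjugates : (q k : ℕ) → Carrier → Fin k → Carrier
  conjugates q k x j = pow x (q ℕ.^ toℕ j)

  -- membership in F_q, viewed as the subfield {y | y^q = y} of the ambient field
  InFq : ℕ → Carrier → Set ℓ
  InFq q y = pow y q ≈ y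

module Submission where

-- Let σ be the Frobenius x ↦ x^q. Over F_q the elements t₁ … t_m are dependent exactly when
-- det (σʲ tᵢ) vanishes, so in (i) the first condition says that x, σx, …, σᵏ⁻¹x are independent,
-- and the second that x, σ²x, …, σᵏx are dependent: together, that the monic F ∈ F_q[X] of least
-- degree with F(σ)x = 0 has degree k and no term in X. Dividing X^n - 1, which σ satisfies, by F
-- leaves no remainder, whence (ii). Conversely, for a factorisation X^n - 1 = F G into monic
-- polynomials there is an x = G(σ)y whose minimal polynomial is F. This is shown by induction on
-- deg F, splitting off an irreducible factor of F; it needs only that σ satisfies no nonzero
-- polynomial of degree below n, which holds because a polynomial of degree < q^n cannot vanish on
-- all of K.

open import Defs
open import Algebra.Bundles using (CommutativeMonoid; CommutativeRing)
open import Algebra.Structures using (IsCommutativeMonoid)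
import Algebra.Properties.CommutativeMonoid.Sum
import Algebra.Properties.CommutativeSemiring.Binomial
import Algebra.Properties.CommutativeSemiring.Exp
import Algebra.Properties.Ring
import Algebra.Properties.Semiring.Exp
import Algebra.Properties.Semiring.Mult
import Algebra.Properties.Semiring.Sum
import Algebra.Solver.Ring.NaturalCoefficients.Default
open import Data.Empty using (⊥)
open import Data.Fin as Fin using (Fin; zero; suc; toℕ; punchIn; punchOut; inject₁; fromℕ; fromℕ<)
open import Data.Fin.Permutation using (Permutation′; permutation)
import Data.Fin.Properties as Fin
open import Data.List using (List; []; _∷_; length; applyUpTo)
open import Data.List.Relation.Unary.All using (All; []; _∷_)
open import Data.List.Relation.Unary.All.Properties using (applyUpTo⁺₂)
open import Data.Nat as ℕ using (ℕ; zero; suc; _∸_; _≤_; _^_; _!)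
open import Data.Nat.Combinatorics using (nCk≡n!/k![n-k]!; [n∸k]!k!∣n!; nCn≡1) renaming (_C_ to _choose_)
open import Data.Nat.Divisibility using (_∣_; divides; divides-refl; ∣⇒≤)
open import Data.Nat.DivMod using (m/n*n≡m)
open import Data.Nat.Induction using (<-rec)
open import Data.Nat.Primality using (Prime; euclidsLemma; ¬prime[1]; prime⇒nonZero; prime⇒nonTrivial)
import Data.Nat.Properties as ℕ
open import Data.Product using (∃; _×_; _,_; proj₁; proj₂)
open import Data.Sum using (_⊎_; inj₁; inj₂)
open import Data.Vec.Functional using (insertAt)
import Data.Vec.Functional.Properties as Vec
open import Function.Bundles using (_⇔_; mk⇔)
open import Relation.Binary using (Decidable; tri<; tri≈; tri>)
open import Relation.Binary.PropositionalEquality as ≡ using (_≡_; _≢_)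
import Relation.Binary.Reasoning.Setoid
open import Relation.Nullary using (¬_; yes; no; contradiction; ¬?)
open import Relation.Nullary.Decidable using (decidable-stable; map′; _×-dec_)

-- Determinants and linear systems

-- In both determinants of (i) the entry at (i, j) is σʲ applied to σ^(e_i) x, where e_i is the
-- exponent of row i, because powers of σ commute. Row i thus belongs to the element σ^(e_i) x and
-- column j to the power σʲ, which turns Δ₁ itself into a Moore determinant, up to transposition.
-- The obstacle in the converse is that X^n - 1 may have repeated factors, so K need not split into
-- pieces belonging to distinct irreducible polynomials. Hence one irreducible factor P is added at
-- a time: given x such that P(σ)x has minimal polynomial h/P, the vector x can fail to have minimal
-- polynomial h only if h/P kills it, and a vector killed by P is then added to x. Irreducibility is
-- never tested; it is replaced by least degree. Having a least degree is a statement about an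
-- undecided predicate, so the construction runs under a double negation. This is removed at the
-- end, since (i) can be decided by a search through the finite field K.

adjacent-punchIn : ∀ {n} (j : Fin (suc (suc n))) (i : Fin (suc n)) → j ≢ inject₁ i → j ≢ suc i →
                   ∃ λ (i′ : Fin n) → punchIn j (inject₁ i′) ≡ inject₁ i × punchIn j (suc i′) ≡ suc i
adjacent-punchIn zero zero p q = contradiction ≡.refl p
adjacent-punchIn zero (suc i) p q = i , ≡.refl , ≡.refl
adjacent-punchIn (suc zero) zero p q = contradiction ≡.refl q
adjacent-punchIn {suc n} (suc (suc j)) zero p q = zero , ≡.refl , ≡.refl
adjacent-punchIn {suc n} (suc j) (suc i) p q =
  let i′ , e , e′ = adjacent-punchIn j i (λ e → p (≡.cong suc e)) (λ e → q (≡.cong suc e))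
  in suc i′ , ≡.cong suc e , ≡.cong suc e′

-- For the two terms that survive when a determinant with equal adjacent columns is expanded:
-- wherever their minors pick different columns, these are the two equal ones.
punchIn-adjacent : ∀ {n} (i c : Fin n) → punchIn (inject₁ i) c ≡ punchIn (suc i) c
                   ⊎ (punchIn (inject₁ i) c ≡ suc i × punchIn (suc i) c ≡ inject₁ i)
punchIn-adjacent zero zero = inj₂ (≡.refl , ≡.refl)
punchIn-adjacent zero (suc c) = inj₁ ≡.refl
punchIn-adjacent (suc i) zero = inj₁ ≡.refl
punchIn-adjacent (suc i) (suc c) with punchIn-adjacent i c
... | inj₁ e = inj₁ (≡.cong suc e)
... | inj₂ (e , e′) = inj₂ (≡.cong suc e , ≡.cong suc e′)

module Determinants {c ℓ} (K : CommutativeRing c ℓ) where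
  open CommutativeRing K hiding (zero)
  open Algebra.Properties.Semiring.Sum semiring
    using (sum; sum-cong-≋; sum-replicate-zero; ∑-distrib-+; ∑-comm; *-distribˡ-sum; *-distribʳ-sum; sum-remove)
  open Algebra.Properties.Ring ring using (-0#≈0#; -‿+-comm; -‿distribʳ-*)
  open Relation.Binary.Reasoning.Setoid setoid

  open Algebra.Solver.Ring.NaturalCoefficients.Default commutativeSemiring using (solve; _:=_; _:+_; _:*_; con)

  -- Opaque, so that unification can read f off ∑ f.
  opaque
    ∑ : ∀ {n} → (Fin n → Carrier) → Carrier
    ∑ {n} = sumFin K n

    ∑≡sumFin : ∀ {n} (f : Fin n → Carrier) → ∑ f ≡ sumFin K n f
    ∑≡sumFin f = ≡.refl

    ∑≡sum : ∀ {n} (f : Fin n → Carrier) → ∑ f ≡ sum f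
    ∑≡sum {zero} f = ≡.refl
    ∑≡sum {suc n} f = ≡.cong (f zero +_) (∑≡sum (λ i → f (suc i)))

    ∑-empty : (f : Fin 0 → Carrier) → ∑ f ≈ 0#
    ∑-empty f = refl

    ∑-suc : ∀ {n} (f : Fin (suc n) → Carrier) → ∑ f ≈ f zero + ∑ (λ i → f (suc i))
    ∑-suc f = refl

  ∑≈sum : ∀ {n} (f : Fin n → Carrier) → ∑ f ≈ sum f
  ∑≈sum f = reflexive (∑≡sum f)

  ∑-cong : ∀ {n} {f g : Fin n → Carrier} → (∀ i → f i ≈ g i) → ∑ f ≈ ∑ g
  ∑-cong {f = f} {g} e = trans (∑≈sum f) (trans (sum-cong-≋ e) (sym (∑≈sum g)))

  ∑-zero : ∀ {n} {f : Fin n → Carrier} → (∀ i → f i ≈ 0#) → ∑ f ≈ 0#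
  ∑-zero {n} {f} e = trans (∑≈sum f) (trans (sum-cong-≋ e) (sum-replicate-zero n))

  ∑-+ : ∀ {n} (f g : Fin n → Carrier) → ∑ (λ i → f i + g i) ≈ ∑ f + ∑ g
  ∑-+ f g = trans (∑≈sum (λ i → f i + g i)) (trans (∑-distrib-+ f g) (sym (+-cong (∑≈sum f) (∑≈sum g))))

  ∑-*ˡ : ∀ {n} a (f : Fin n → Carrier) → a * ∑ f ≈ ∑ (λ i → a * f i)
  ∑-*ˡ a f = trans (*-congˡ (∑≈sum f)) (trans (*-distribˡ-sum a f) (sym (∑≈sum (λ i → a * f i))))

  ∑-*ʳ : ∀ {n} a (f : Fin n → Carrier) → ∑ f * a ≈ ∑ (λ i → f i * a)
  ∑-*ʳ a f = trans (*-congʳ (∑≈sum f)) (trans (*-distribʳ-sum a f) (sym (∑≈sum (λ i → f i * a))))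

  ∑-swap : ∀ {m n} (f : Fin m → Fin n → Carrier) → ∑ (λ i → ∑ (f i)) ≈ ∑ (λ j → ∑ (λ i → f i j))
  ∑-swap f = begin
    ∑ (λ i → ∑ (f i))               ≈⟨ ∑-cong (λ i → ∑≈sum (f i)) ⟩
    ∑ (λ i → sum (f i))             ≈⟨ ∑≈sum (λ i → sum (f i)) ⟩
    sum (λ i → sum (f i))           ≈⟨ ∑-comm f ⟩
    sum (λ j → sum (λ i → f i j))   ≈⟨ ∑≈sum (λ j → sum (λ i → f i j)) ⟨
    ∑ (λ j → sum (λ i → f i j))     ≈⟨ ∑-cong (λ j → sym (∑≈sum (λ i → f i j))) ⟩
    ∑ (λ j → ∑ (λ i → f i j))       ∎

  ∑-punchIn : ∀ {n} (j : Fin (suc n)) (f : Fin (suc n) → Carrier) → ∑ f ≈ f j + ∑ (λ i → f (punchIn j i))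
  ∑-punchIn j f = trans (∑≈sum f) (trans (sum-remove f) (+-congˡ (sym (∑≈sum (λ i → f (punchIn j i))))))

  ∑-single : ∀ {n} (j : Fin n) (f : Fin n → Carrier) → (∀ i → i ≢ j → f i ≈ 0#) → ∑ f ≈ f j
  ∑-single {suc n} j f e = trans (∑-punchIn j f)
    (trans (+-congˡ (∑-zero (λ i → e (punchIn j i) (Fin.punchInᵢ≢i j i)))) (+-identityʳ _))

  ∑-adjacent : ∀ {n} (i : Fin n) (f : Fin (suc n) → Carrier) →
               (∀ j → j ≢ inject₁ i → j ≢ suc i → f j ≈ 0#) →
               f (inject₁ i) + f (suc i) ≈ 0# → ∑ f ≈ 0#
  ∑-adjacent zero f z e = begin
    ∑ f                                                  ≈⟨ trans (∑-suc f) (+-congˡ (∑-suc _)) ⟩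
    f zero + (f (suc zero) + ∑ (λ j → f (suc (suc j))))  ≈⟨ +-assoc _ _ _ ⟨
    f zero + f (suc zero) + ∑ (λ j → f (suc (suc j)))    ≈⟨ +-cong e (∑-zero (λ j → z (suc (suc j)) (λ ()) (λ ()))) ⟩
    0# + 0#                                              ≈⟨ +-identityˡ 0# ⟩
    0#                                                   ∎
  ∑-adjacent (suc i) f z e = trans (∑-suc f) (trans (+-cong (z zero (λ ()) (λ ()))
      (∑-adjacent i (λ j → f (suc j)) (λ j p q → z (suc j) (λ e → p (Fin.suc-injective e)) (λ e → q (Fin.suc-injective e))) e))
    (+-identityˡ 0#))

  signed-cong : ∀ m {x y} → x ≈ y → signed K m x ≈ signed K m y
  signed-cong zero e = e
  signed-cong (suc m) e = -‿cong (signed-cong m e)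

  signed-0 : ∀ m → signed K m 0# ≈ 0#
  signed-0 zero = refl
  signed-0 (suc m) = trans (-‿cong (signed-0 m)) -0#≈0#

  signed-≈0 : ∀ m {x} → x ≈ 0# → signed K m x ≈ 0#
  signed-≈0 m e = trans (signed-cong m e) (signed-0 m)

  signed-linear : ∀ m x a y → signed K m (x + a * y) ≈ signed K m x + a * signed K m y
  signed-linear zero x a y = refl
  signed-linear (suc m) x a y = trans (-‿cong (signed-linear m x a y))
    (trans (sym (-‿+-comm _ _)) (+-congˡ (-‿distribʳ-* a _)))

  Matrix : ℕ → ℕ → Set c
  Matrix m n = Fin m → Fin n → Carrier

  minor : ∀ {m n} → Matrix (suc m) (suc n) → Fin (suc n) → Matrix m n
  minor M j r c = M (suc r) (punchIn j c)

  term : ∀ {n} → Matrix (suc n) (suc n) → Fin (suc n) → Carrier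
  term {n} M j = signed K (toℕ j) (M zero j * det K n (minor M j))

  det-expand : ∀ n (M : Matrix (suc n) (suc n)) → det K (suc n) M ≈ ∑ (term M)
  det-expand n M = reflexive (≡.sym (∑≡sumFin (term M)))

  det-cong : ∀ n {M N : Matrix n n} → (∀ r c → M r c ≈ N r c) → det K n M ≈ det K n N
  det-cong zero e = refl
  det-cong (suc n) {M} {N} e = trans (det-expand n M) (trans (∑-cong λ j → signed-cong (toℕ j)
    (*-cong (e zero j) (det-cong n λ r c → e (suc r) (punchIn j c)))) (sym (det-expand n N)))

  -- Every term of the expansion along the first row splits: omitting column j leaves a common minor
  -- and a split entry, omitting another column leaves a common entry and a minor that splits by
  -- induction.
  det-linear : ∀ n {A B C : Matrix n n} j a →
               (∀ r c → c ≢ j → C r c ≈ A r c) → (∀ r c → c ≢ j → C r c ≈ B r c) →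
               (∀ r → C r j ≈ A r j + a * B r j) → det K n C ≈ det K n A + a * det K n B
  det-linear (suc n) {A} {B} {C} j a ca cb cj = begin
    det K (suc n) C                     ≈⟨ trans (det-expand n C) (∑-cong step) ⟩
    ∑ (λ i → term A i + a * term B i)   ≈⟨ ∑-+ (term A) (λ i → a * term B i) ⟩
    ∑ (term A) + ∑ (λ i → a * term B i) ≈⟨ +-congˡ (∑-*ˡ a (term B)) ⟨
    ∑ (term A) + a * ∑ (term B)         ≈⟨ +-cong (det-expand n A) (*-congˡ (det-expand n B)) ⟨
    det K (suc n) A + a * det K (suc n) B ∎
    where
    ring₁ : ∀ x a y d → (x + a * y) * d ≈ x * d + a * (y * d)
    ring₁ = solve 4 (λ x a y d → (x :+ a :* y) :* d := x :* d :+ a :* (y :* d)) refl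
    ring₂ : ∀ x a d d′ → x * (d + a * d′) ≈ x * d + a * (x * d′)
    ring₂ = solve 4 (λ x a d d′ → x :* (d :+ a :* d′) := x :* d :+ a :* (x :* d′)) refl
    step : ∀ i → term C i ≈ term A i + a * term B i
    step i with i Fin.≟ j
    ... | yes ≡.refl = trans (signed-cong (toℕ i) (begin
      C zero i * det K n (minor C i)                       ≈⟨ *-congʳ (cj zero) ⟩
      (A zero i + a * B zero i) * det K n (minor C i)      ≈⟨ ring₁ _ _ _ _ ⟩
      A zero i * det K n (minor C i) + a * (B zero i * det K n (minor C i))
        ≈⟨ +-cong (*-congˡ (det-cong n λ r c → ca (suc r) _ (Fin.punchInᵢ≢i i c)))
                  (*-congˡ (*-congˡ (det-cong n λ r c → cb (suc r) _ (Fin.punchInᵢ≢i i c)))) ⟩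
      A zero i * det K n (minor A i) + a * (B zero i * det K n (minor B i)) ∎))
      (signed-linear (toℕ i) _ _ _)
    ... | no i≢j = trans (signed-cong (toℕ i) (begin
      C zero i * det K n (minor C i)
        ≈⟨ *-congˡ (det-linear n (punchOut i≢j) a
             (λ r c p → ca (suc r) _ (off c p)) (λ r c p → cb (suc r) _ (off c p))
             (λ r → ≡.subst (λ j → C (suc r) j ≈ A (suc r) j + a * B (suc r) j)
                      (≡.sym (Fin.punchIn-punchOut i≢j)) (cj (suc r)))) ⟩
      C zero i * (det K n (minor A i) + a * det K n (minor B i)) ≈⟨ ring₂ _ _ _ _ ⟩
      C zero i * det K n (minor A i) + a * (C zero i * det K n (minor B i))
        ≈⟨ +-cong (*-congʳ (ca zero i i≢j)) (*-congˡ (*-congʳ (cb zero i i≢j))) ⟩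
      A zero i * det K n (minor A i) + a * (B zero i * det K n (minor B i)) ∎))
      (signed-linear (toℕ i) _ _ _)
      where
      off : ∀ c → c ≢ punchOut i≢j → punchIn i c ≢ j
      off c p e = p (Fin.punchIn-injective i c (punchOut i≢j) (≡.trans e (≡.sym (Fin.punchIn-punchOut i≢j))))

  -- A minor that omits some other column still has the equal columns side by side and vanishes by
  -- induction. The two remaining terms differ only in sign, their positions being consecutive.
  det-adjacent : ∀ n (M : Matrix (suc n) (suc n)) (i : Fin n) →
                 (∀ r → M r (inject₁ i) ≈ M r (suc i)) → det K (suc n) M ≈ 0#
  det-adjacent (suc n) M i e = trans (det-expand (suc n) M) (∑-adjacent i (term M) other pair)
    where
    other : ∀ j → j ≢ inject₁ i → j ≢ suc i → term M j ≈ 0#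
    other j p q =
      let i′ , e₁ , e₂ = adjacent-punchIn j i p q
      in signed-≈0 (toℕ j) (trans (*-congˡ (det-adjacent n (minor M j) i′ λ r →
           trans (reflexive (≡.cong (M (suc r)) e₁)) (trans (e (suc r)) (reflexive (≡.cong (M (suc r)) (≡.sym e₂))))))
           (zeroʳ _))
    minors : ∀ r c → M (suc r) (punchIn (inject₁ i) c) ≈ M (suc r) (punchIn (suc i) c)
    minors r c with punchIn-adjacent i c
    ... | inj₁ p = reflexive (≡.cong (M (suc r)) p)
    ... | inj₂ (p , q) = trans (reflexive (≡.cong (M (suc r)) p))
                         (trans (sym (e (suc r))) (reflexive (≡.cong (M (suc r)) (≡.sym q))))
    pair : term M (inject₁ i) + term M (suc i) ≈ 0#
    pair = trans (+-congʳ (trans (reflexive (≡.cong (λ m → signed K m (M zero (inject₁ i) * det K (suc n) (minor M (inject₁ i)))) (Fin.toℕ-inject₁ i)))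
             (signed-cong (toℕ i) (*-cong (e zero) (det-cong (suc n) minors))))) (-‿inverseʳ _)

  replaceColumn : ∀ {m n} → Matrix m n → Fin n → (Fin m → Carrier) → Matrix m n
  replaceColumn M j v r c with c Fin.≟ j
  ... | yes _ = v r
  ... | no _ = M r c

  replaceColumn-at : ∀ {m n} (M : Matrix m n) j v r → replaceColumn M j v r j ≈ v r
  replaceColumn-at M j v r with j Fin.≟ j
  ... | yes _ = refl
  ... | no p = contradiction ≡.refl p

  replaceColumn-off : ∀ {m n} (M : Matrix m n) j v r c → c ≢ j → replaceColumn M j v r c ≈ M r c
  replaceColumn-off M j v r c p with c Fin.≟ j
  ... | yes e = contradiction e p
  ... | no _ = refl

  -- A column equal to one further to the left is moved one step closer to it: the determinant
  -- with both columns p and j replaced by their sum vanishes, and expanding it bilinearly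
  -- expresses det M through determinants already known to vanish.
  det-alternating< : ∀ d n (M : Matrix n n) (i j : Fin n) → toℕ j ≡ suc (d ℕ.+ toℕ i) →
                     (∀ r → M r i ≈ M r j) → det K n M ≈ 0#
  det-alternating< zero (suc n) M i (suc j) d≡ e = det-adjacent n M j λ r →
    trans (reflexive (≡.cong (M r) (Fin.toℕ-injective (≡.trans (Fin.toℕ-inject₁ j) (ℕ.suc-injective d≡))))) (e r)
  det-alternating< (suc d) (suc n) M i (suc j) d≡ e = begin
    det K (suc n) M                                          ≈⟨ x+y0 _ _ ⟩
    det K (suc n) M + 1# * 0#                                ≈⟨ +-congˡ (*-congˡ both≈0) ⟨
    det K (suc n) M + 1# * det K (suc n) B′                  ≈⟨ lin-j ⟨
    det K (suc n) B                                          ≈⟨ x+y0 _ _ ⟩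
    det K (suc n) B + 1# * 0#                                ≈⟨ +-congˡ (*-congˡ ih) ⟨
    det K (suc n) B + 1# * det K (suc n) A                   ≈⟨ lin-p ⟨
    det K (suc n) C                                          ≈⟨ det-adjacent n C j C-adj ⟩
    0#                                                       ∎
    where
    x+y0 : ∀ x y → x ≈ x + y * 0#
    x+y0 = solve 2 (λ x y → x := x :+ y :* con 0) refl
    p = inject₁ j
    p≢j : p ≢ suc j
    p≢j q = ℕ.m≢1+n+m (toℕ j) {0} (≡.trans (≡.sym (Fin.toℕ-inject₁ j)) (≡.cong toℕ q))
    toℕp : toℕ p ≡ suc (d ℕ.+ toℕ i)
    toℕp = ≡.trans (Fin.toℕ-inject₁ j) (ℕ.suc-injective d≡)
    i≢p : i ≢ p
    i≢p q = ℕ.m≢1+n+m (toℕ i) {d} (≡.trans (≡.cong toℕ q) toℕp)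
    i≢j : i ≢ suc j
    i≢j q = ℕ.m≢1+n+m (toℕ i) {suc d} (≡.trans (≡.cong toℕ q) d≡)
    colₚ colⱼ s : Fin (suc n) → Carrier
    colₚ r = M r p
    colⱼ r = M r (suc j)
    s r = M r p + 1# * M r (suc j)
    B = replaceColumn M (suc j) s
    B′ = replaceColumn M (suc j) colₚ
    C = replaceColumn B p s
    A = replaceColumn B p colⱼ
    both≈0 : det K (suc n) B′ ≈ 0#
    both≈0 = det-adjacent n B′ j λ r → trans (replaceColumn-off M (suc j) colₚ r p p≢j) (sym (replaceColumn-at M (suc j) colₚ r))
    ring₁ : ∀ x y → x + 1# * y ≈ y + 1# * x
    ring₁ = solve 2 (λ x y → x :+ con 1 :* y := y :+ con 1 :* x) refl
    lin-j : det K (suc n) B ≈ det K (suc n) M + 1# * det K (suc n) B′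
    lin-j = det-linear (suc n) (suc j) 1#
      (λ r c q → replaceColumn-off M (suc j) s r c q)
      (λ r c q → trans (replaceColumn-off M (suc j) s r c q) (sym (replaceColumn-off M (suc j) colₚ r c q)))
      (λ r → trans (replaceColumn-at M (suc j) s r) (trans (ring₁ _ _)
                (+-congˡ (*-congˡ (sym (replaceColumn-at M (suc j) colₚ r))))))
    lin-p : det K (suc n) C ≈ det K (suc n) B + 1# * det K (suc n) A
    lin-p = det-linear (suc n) p 1#
      (λ r c q → replaceColumn-off B p s r c q)
      (λ r c q → trans (replaceColumn-off B p s r c q) (sym (replaceColumn-off B p colⱼ r c q)))
      (λ r → trans (replaceColumn-at B p s r) (+-cong (sym (replaceColumn-off M (suc j) s r p p≢j))
                (*-congˡ (sym (replaceColumn-at B p colⱼ r)))))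
    C-adj : ∀ r → C r p ≈ C r (suc j)
    C-adj r = trans (replaceColumn-at B p s r) (sym (trans (replaceColumn-off B p s r (suc j) (λ q → p≢j (≡.sym q)))
                (replaceColumn-at M (suc j) s r)))
    ih : det K (suc n) A ≈ 0#
    ih = det-alternating< d (suc n) A i p toℕp λ r → begin
      A r i        ≈⟨ replaceColumn-off B p colⱼ r i i≢p ⟩
      B r i        ≈⟨ replaceColumn-off M (suc j) s r i i≢j ⟩
      M r i        ≈⟨ e r ⟩
      M r (suc j)  ≈⟨ replaceColumn-at B p colⱼ r ⟨
      A r p        ∎

  det-alternating : ∀ n (M : Matrix n n) (i j : Fin n) → i ≢ j → (∀ r → M r i ≈ M r j) → det K n M ≈ 0#
  det-alternating n M i j i≢j e with ℕ.<-cmp (toℕ i) (toℕ j)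
  ... | tri< i<j _ _ with ℕ.m≤n⇒∃[o]m+o≡n i<j
  ...   | d , q = det-alternating< d n M i j (≡.sym (≡.trans (≡.cong suc (ℕ.+-comm d (toℕ i))) q)) e
  det-alternating n M i j i≢j e | tri≈ _ q _ = contradiction (Fin.toℕ-injective q) i≢j
  det-alternating n M i j i≢j e | tri> _ _ j<i with ℕ.m≤n⇒∃[o]m+o≡n j<i
  ...   | d , q = det-alternating< d n M j i (≡.sym (≡.trans (≡.cong suc (ℕ.+-comm d (toℕ j))) q)) (λ r → sym (e r))

-- Elimination, kernels and vanishing determinants over a field

module Kernels {c ℓ} (K : CommutativeRing c ℓ) (isField : IsField K)
               (_≟_ : Decidable (CommutativeRing._≈_ K)) where
  open CommutativeRing K hiding (zero)
  open Determinants K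
  open IsField isField
  open Algebra.Solver.Ring.NaturalCoefficients.Default commutativeSemiring using (solve; _:=_; _:+_; _:*_)
  open Algebra.Properties.Ring ring using (-0#≈0#; -‿distribˡ-*; -‿distribʳ-*; -‿involutive; -1*x≈-x; +-inverseˡ-unique)
  open Relation.Binary.Reasoning.Setoid setoid

  infix 4 _≉0
  _≉0 : Carrier → Set ℓ
  x ≉0 = ¬ (x ≈ 0#)

  x*y≈0⇒y≈0 : ∀ {x y} → x ≉0 → x * y ≈ 0# → y ≈ 0#
  x*y≈0⇒y≈0 {x} {y} x≉0 e with x⁻¹ , xx⁻¹ ← inverse x x≉0 = begin
    y               ≈⟨ *-identityˡ y ⟨
    1# * y          ≈⟨ *-congʳ xx⁻¹ ⟨
    x * x⁻¹ * y     ≈⟨ solve 3 (λ x u y → x :* u :* y := u :* (x :* y)) refl x x⁻¹ y ⟩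
    x⁻¹ * (x * y)   ≈⟨ *-congˡ e ⟩
    x⁻¹ * 0#        ≈⟨ zeroʳ x⁻¹ ⟩
    0#              ∎

  *-≉0 : ∀ {x y} → x ≉0 → y ≉0 → x * y ≉0
  *-≉0 x≉0 y≉0 e = y≉0 (x*y≈0⇒y≈0 x≉0 e)

  allZero? : ∀ {n} (v : Fin n → Carrier) → (∀ i → v i ≈ 0#) ⊎ ∃ λ i → v i ≉0
  allZero? v with Fin.any? (λ i → ¬? (v i ≟ 0#))
  ... | yes p = inj₂ p
  ... | no p = inj₁ λ i → decidable-stable (v i ≟ 0#) λ q → p (i , q)

  addColumn : ∀ {m n} → Matrix m n → Fin n → (Fin n → Carrier) → Matrix m n
  addColumn M j a r c = M r c + a c * M r j

  -- Induction on a bound for the support of `a`: linearity splits off what was added to the last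
  -- affected column, which gives a determinant with two equal columns, or the coefficient 0 if that
  -- column is column j.
  det-addColumn-support : ∀ m n (M : Matrix n n) j (a : Fin n → Carrier) → a j ≈ 0# →
                          (∀ i → m ℕ.≤ toℕ i → a i ≈ 0#) → det K n (addColumn M j a) ≈ det K n M
  det-addColumn-support zero n M j a aj s = det-cong n λ r i →
    trans (+-congˡ (trans (*-congʳ (s i ℕ.z≤n)) (zeroˡ _))) (+-identityʳ _)
  det-addColumn-support (suc m) n M j a aj s with m ℕ.<? n
  ... | no m≮n = det-addColumn-support m n M j a aj λ i m≤i →
    contradiction (ℕ.≤-<-trans m≤i (Fin.toℕ<n i)) m≮n
  ... | yes m<n = begin
    det K n C                       ≈⟨ det-linear n i₀ (a i₀) offA offB at ⟩
    det K n A + a i₀ * det K n B    ≈⟨ +-cong (det-addColumn-support m n M j a′ a′j s′) B-vanishes ⟩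
    det K n M + 0#                  ≈⟨ +-identityʳ _ ⟩
    det K n M                       ∎
    where
    i₀ = fromℕ< m<n
    a′ : Fin n → Carrier
    a′ i with i Fin.≟ i₀
    ... | yes _ = 0#
    ... | no _ = a i
    a′-off : ∀ i → i ≢ i₀ → a′ i ≈ a i
    a′-off i p with i Fin.≟ i₀
    ... | yes q = contradiction q p
    ... | no _ = refl
    a′-at : a′ i₀ ≈ 0#
    a′-at with i₀ Fin.≟ i₀
    ... | yes _ = refl
    ... | no p = contradiction ≡.refl p
    a′j : a′ j ≈ 0#
    a′j with j Fin.≟ i₀
    ... | yes _ = refl
    ... | no _ = aj
    s′ : ∀ i → m ℕ.≤ toℕ i → a′ i ≈ 0#
    s′ i m≤i with i Fin.≟ i₀
    ... | yes _ = refl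
    ... | no p = s i (ℕ.≤∧≢⇒< m≤i λ q → p (Fin.toℕ-injective (≡.trans (≡.sym q) (≡.sym (Fin.toℕ-fromℕ< m<n)))))
    A = addColumn M j a′
    B = replaceColumn A i₀ (λ r → M r j)
    C = addColumn M j a
    offA : ∀ r i → i ≢ i₀ → C r i ≈ A r i
    offA r i p = +-congˡ (*-congʳ (sym (a′-off i p)))
    offB : ∀ r i → i ≢ i₀ → C r i ≈ B r i
    offB r i p = trans (offA r i p) (sym (replaceColumn-off A i₀ _ r i p))
    at : ∀ r → C r i₀ ≈ A r i₀ + a i₀ * B r i₀
    at r = +-cong
      (sym (trans (+-congˡ (trans (*-congʳ a′-at) (zeroˡ _))) (+-identityʳ _)))
      (*-congˡ (sym (replaceColumn-at A i₀ _ r)))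
    B-vanishes : a i₀ * det K n B ≈ 0#
    B-vanishes with i₀ Fin.≟ j
    ... | yes p = trans (*-congʳ (trans (reflexive (≡.cong a p)) aj)) (zeroˡ _)
    ... | no p = trans (*-congˡ (det-alternating n B i₀ j p λ r →
        trans (replaceColumn-at A i₀ _ r) (sym (trans (replaceColumn-off A i₀ _ r j (λ q → p (≡.sym q)))
          (trans (+-congˡ (trans (*-congʳ a′j) (zeroˡ _))) (+-identityʳ _)))))) (zeroʳ _)

  det-addColumn : ∀ n (M : Matrix n n) j (a : Fin n → Carrier) → a j ≈ 0# →
                  det K n (addColumn M j a) ≈ det K n M
  det-addColumn n M j a aj = det-addColumn-support n n M j a aj λ i n≤i →
    contradiction (Fin.toℕ<n i) (ℕ.≤⇒≯ n≤i)

  Nonzero : ∀ {n} → (Fin n → Carrier) → Set ℓ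
  Nonzero v = ∃ λ i → v i ≉0

  Kernel : ∀ {m n} → Matrix m n → (Fin n → Carrier) → Set ℓ
  Kernel M v = ∀ r → ∑ (λ i → M r i * v i) ≈ 0#

  -- One elimination step. Column operations clear the first row outside column j; `reduced` is then
  -- the Schur complement of the pivot, and its kernel is that of `M` with coordinate j forgotten.
  module Pivot {m n} (M : Matrix (suc m) (suc n)) (j : Fin (suc n)) (pivot≉0 : M zero j ≉0) where
    pivot⁻¹ = proj₁ (inverse (M zero j) pivot≉0)

    ratio : Fin n → Carrier
    ratio i = - (pivot⁻¹ * M zero (punchIn j i))

    eliminated : Fin (suc m) → Fin n → Carrier
    eliminated r i = M r (punchIn j i) + ratio i * M r j

    reduced : Matrix m n
    reduced r = eliminated (suc r)

    eliminated-zero : ∀ i → eliminated zero i ≈ 0#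
    eliminated-zero i = begin
      x + - (u * x) * M zero j       ≈⟨ +-congˡ (-‿distribˡ-* _ _) ⟨
      x + - (u * x * M zero j)       ≈⟨ +-congˡ (-‿cong (solve 3 (λ u x y → u :* x :* y := y :* u :* x) refl u x (M zero j))) ⟩
      x + - (M zero j * u * x)       ≈⟨ +-congˡ (-‿cong (trans (*-congʳ (proj₂ (inverse (M zero j) pivot≉0))) (*-identityˡ x))) ⟩
      x + - x                        ≈⟨ -‿inverseʳ x ⟩
      0#                             ∎
      where
      x = M zero (punchIn j i)
      u = pivot⁻¹

    -- Substituting for the unknown `v j` has the same effect on every equation as the column
    -- operations have on the matrix.
    combine : ∀ (v : Fin (suc n) → Carrier) r → v j ≈ ∑ (λ i → ratio i * v (punchIn j i)) →
              ∑ (λ i → M r i * v i) ≈ ∑ (λ i → eliminated r i * v (punchIn j i))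
    combine v r e = begin
      ∑ (λ i → M r i * v i)
        ≈⟨ ∑-punchIn j _ ⟩
      M r j * v j + ∑ (λ i → M r (punchIn j i) * v (punchIn j i))
        ≈⟨ +-congʳ (trans (*-congˡ e) (∑-*ˡ (M r j) _)) ⟩
      ∑ (λ i → M r j * (ratio i * v (punchIn j i))) + ∑ (λ i → M r (punchIn j i) * v (punchIn j i))
        ≈⟨ ∑-+ _ _ ⟨
      ∑ (λ i → M r j * (ratio i * v (punchIn j i)) + M r (punchIn j i) * v (punchIn j i))
        ≈⟨ ∑-cong (λ i → solve 4 (λ m a v m′ → m :* (a :* v) :+ m′ :* v := (m′ :+ a :* m) :* v) refl
             (M r j) (ratio i) (v (punchIn j i)) (M r (punchIn j i))) ⟩
      ∑ (λ i → eliminated r i * v (punchIn j i)) ∎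

    lift : (Fin n → Carrier) → Fin (suc n) → Carrier
    lift v = insertAt v j (∑ (λ i → ratio i * v i))

    lift-punchIn : ∀ v i → lift v (punchIn j i) ≈ v i
    lift-punchIn v i = reflexive (Vec.insertAt-punchIn v j _ i)

    lift-kernel : ∀ v → Kernel reduced v → Kernel M (lift v)
    lift-kernel v k r = trans (combine (lift v) r (trans (reflexive (Vec.insertAt-lookup v j _))
        (∑-cong λ i → *-congˡ (sym (lift-punchIn v i))))) (rows r)
      where
      rows : ∀ r → ∑ (λ i → eliminated r i * lift v (punchIn j i)) ≈ 0#
      rows zero = ∑-zero λ i → trans (*-congʳ (eliminated-zero i)) (zeroˡ _)
      rows (suc r) = trans (∑-cong λ i → *-congˡ (lift-punchIn v i)) (k r)

    lift-nonzero : ∀ v → Nonzero v → Nonzero (lift v)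
    lift-nonzero v (i , p) = punchIn j i , λ e → p (trans (sym (lift-punchIn v i)) e)

    kernel-pivot : ∀ (v : Fin (suc n) → Carrier) → Kernel M v → v j ≈ ∑ (λ i → ratio i * v (punchIn j i))
    kernel-pivot v k = begin
      v j                        ≈⟨ *-identityˡ _ ⟨
      1# * v j                   ≈⟨ *-congʳ (trans (sym (proj₂ (inverse (M zero j) pivot≉0))) (*-comm _ _)) ⟩
      u * M zero j * v j         ≈⟨ *-assoc _ _ _ ⟩
      u * (M zero j * v j)       ≈⟨ *-congˡ opposite ⟩
      u * - rest                 ≈⟨ -‿distribʳ-* _ _ ⟨
      - (u * rest)               ≈⟨ neg _ ⟨
      - 1# * (u * rest)          ≈⟨ trans (sym (*-assoc _ _ _)) (∑-*ˡ (- 1# * u) _) ⟩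
      ∑ (λ i → - 1# * u * (M zero (punchIn j i) * v (punchIn j i)))
        ≈⟨ ∑-cong (λ i → trans (solve 4 (λ o u m v → o :* u :* (m :* v) := o :* (u :* m) :* v) refl
             (- 1#) u (M zero (punchIn j i)) (v (punchIn j i))) (*-congʳ (neg _))) ⟩
      ∑ (λ i → ratio i * v (punchIn j i)) ∎
      where
      neg = -1*x≈-x
      u = pivot⁻¹
      rest = ∑ (λ i → M zero (punchIn j i) * v (punchIn j i))
      opposite : M zero j * v j ≈ - rest
      opposite = +-inverseˡ-unique _ _ (trans (sym (∑-punchIn j _)) (k zero))

    restrict-kernel : ∀ v → Kernel M v → Kernel reduced (λ i → v (punchIn j i))
    restrict-kernel v k r = trans (sym (combine v (suc r) (kernel-pivot v k))) (k (suc r))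

    restrict-nonzero : ∀ v → Kernel M v → Nonzero v → Nonzero (λ i → v (punchIn j i))
    restrict-nonzero v k (i , p) with allZero? (λ i → v (punchIn j i))
    ... | inj₂ q = q
    ... | inj₁ z with i Fin.≟ j
    ...   | yes ≡.refl = contradiction (trans (kernel-pivot v k)
              (∑-zero λ i → trans (*-congˡ (z i)) (zeroʳ _))) p
    ...   | no i≢j = contradiction (trans (reflexive (≡.cong v (≡.sym (Fin.punchIn-punchOut j≢i)))) (z _)) p
      where j≢i = λ e → i≢j (≡.sym e)

  -- After the column operations only the pivot is left in the first row, so the expansion has a
  -- single term. The coefficient 0 inserted at j leaves the pivot column itself unchanged.
  det-pivot : ∀ {n} (M : Matrix (suc n) (suc n)) j (p : M zero j ≉0) →
              det K (suc n) M ≈ signed K (toℕ j) (M zero j * det K n (Pivot.reduced M j p))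
  det-pivot {n} M j p = begin
    det K (suc n) M ≈⟨ det-addColumn (suc n) M j a a-at ⟨
    det K (suc n) N ≈⟨ det-expand n N ⟩
    ∑ (term N) ≈⟨ ∑-single j _ (λ i i≢j → signed-≈0 (toℕ i) (trans (*-congʳ (N-zero i i≢j)) (zeroˡ _))) ⟩
    signed K (toℕ j) (N zero j * det K n (minor N j))
      ≈⟨ signed-cong (toℕ j) (*-cong (trans (+-congˡ (trans (*-congʳ a-at) (zeroˡ _))) (+-identityʳ _))
           (det-cong n λ r i → N-punchIn (suc r) i)) ⟩
    signed K (toℕ j) (M zero j * det K n reduced) ∎
    where
    open Pivot M j p
    a = insertAt ratio j 0#
    a-at : a j ≈ 0#
    a-at = reflexive (Vec.insertAt-lookup ratio j 0#)
    N = addColumn M j a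
    N-punchIn : ∀ r i → N r (punchIn j i) ≈ eliminated r i
    N-punchIn r i = +-congˡ (*-congʳ (reflexive (Vec.insertAt-punchIn ratio j 0# i)))
    N-zero : ∀ i → i ≢ j → N zero i ≈ 0#
    N-zero i i≢j = trans (reflexive (≡.cong (N zero) (≡.sym (Fin.punchIn-punchOut j≢i))))
      (trans (N-punchIn zero _) (eliminated-zero _))
      where j≢i = λ e → i≢j (≡.sym e)

  underdetermined : ∀ m (M : Matrix m (suc m)) → ∃ λ v → Kernel M v × Nonzero v
  underdetermined zero M = (λ _ → 1#) , (λ ()) , zero , λ e → 0≉1 (sym e)
  underdetermined (suc m) M with allZero? (M zero)
  ... | inj₂ (j , p) =
    let open Pivot M j p
        v , k , nz = underdetermined m reduced
    in lift v , lift-kernel v k , lift-nonzero v nz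
  -- A zero first row imposes nothing. Fixing the first unknown at 0 keeps one more unknown than
  -- equations.
  ... | inj₁ z with underdetermined m (λ r i → M (suc r) (suc i))
  ...   | v , k , i , p = v′ , k′ , suc i , p
    where
    v′ : Fin (suc (suc m)) → Carrier
    v′ zero = 0#
    v′ (suc i) = v i
    k′ : Kernel M v′
    k′ zero = ∑-zero λ i → trans (*-congʳ (z i)) (zeroˡ _)
    k′ (suc r) = trans (∑-suc _) (trans (+-cong (zeroʳ _) (k r)) (+-identityˡ 0#))

  -- Either the first row vanishes and fewer equations than unknowns remain, or the nonzero pivot is
  -- divided out of the determinant and elimination goes on with a smaller matrix.
  det≈0⇒kernel : ∀ n (M : Matrix n n) → det K n M ≈ 0# → ∃ λ v → Kernel M v × Nonzero v
  det≈0⇒kernel zero M e = contradiction (sym e) 0≉1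
  det≈0⇒kernel (suc n) M e with allZero? (M zero)
  ... | inj₁ z with underdetermined n (λ r → M (suc r))
  ...   | v , k , nz = v , (λ { zero → ∑-zero λ i → trans (*-congʳ (z i)) (zeroˡ _) ; (suc r) → k r }) , nz
  det≈0⇒kernel (suc n) M e | inj₂ (j , p) =
    let open Pivot M j p
        v , k , nz = det≈0⇒kernel n reduced
                       (x*y≈0⇒y≈0 p (signed-injective (toℕ j) (trans (sym (det-pivot M j p)) e)))
    in lift v , lift-kernel v k , lift-nonzero v nz
    where
    signed-injective : ∀ m {x} → signed K m x ≈ 0# → x ≈ 0#
    signed-injective zero e = e
    signed-injective (suc m) {x} e = signed-injective m
      (trans (sym (-‿involutive _)) (trans (-‿cong e) -0#≈0#))

  kernel⇒det≈0 : ∀ n (M : Matrix n n) v → Kernel M v → Nonzero v → det K n M ≈ 0#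
  kernel⇒det≈0 (suc n) M v k nz with allZero? (M zero)
  ... | inj₁ z = trans (det-expand n M) (∑-zero λ j → signed-≈0 (toℕ j) (trans (*-congʳ (z j)) (zeroˡ _)))
  ... | inj₂ (j , p) =
    let open Pivot M j p
    in trans (det-pivot M j p) (signed-≈0 (toℕ j) (trans (*-congˡ
         (kernel⇒det≈0 n reduced _ (restrict-kernel v k) (restrict-nonzero v k nz))) (zeroʳ _)))

  transpose : ∀ {m n} → Matrix m n → Matrix n m
  transpose M i j = M j i

  -- A relation with r-th coefficient nonzero makes row r redundant, leaving fewer equations
  -- than unknowns.
  kernel-transpose : ∀ n (M : Matrix n n) v → Kernel (transpose M) v → Nonzero v →
                     ∃ λ w → Kernel M w × Nonzero w
  kernel-transpose (suc n) M v k (r , p) with underdetermined n (λ i → M (punchIn r i))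
  ... | w , kw , nz = w , rows , nz
    where
    row : Fin (suc n) → Carrier
    row i = ∑ (λ j → M i j * w j)
    total : ∑ (λ i → v i * row i) ≈ 0#
    total = begin
      ∑ (λ i → v i * row i)                       ≈⟨ ∑-cong (λ i → ∑-*ˡ (v i) _) ⟩
      ∑ (λ i → ∑ (λ j → v i * (M i j * w j)))     ≈⟨ ∑-swap _ ⟩
      ∑ (λ j → ∑ (λ i → v i * (M i j * w j)))
        ≈⟨ ∑-cong (λ j → trans (∑-cong λ i → solve 3 (λ v m w → v :* (m :* w) := m :* v :* w) refl (v i) (M i j) (w j))
             (sym (∑-*ʳ (w j) _))) ⟩
      ∑ (λ j → ∑ (λ i → M i j * v i) * w j)       ≈⟨ ∑-zero (λ j → trans (*-congʳ (k j)) (zeroˡ _)) ⟩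
      0#                                          ∎
    row-r : row r ≈ 0#
    row-r = x*y≈0⇒y≈0 p (begin
      v r * row r                                                   ≈⟨ +-identityʳ _ ⟨
      v r * row r + 0#                                              ≈⟨ +-congˡ (∑-zero (λ i → trans (*-congˡ (kw i)) (zeroʳ _))) ⟨
      v r * row r + ∑ (λ i → v (punchIn r i) * row (punchIn r i))   ≈⟨ ∑-punchIn r _ ⟨
      ∑ (λ i → v i * row i)                                         ≈⟨ total ⟩
      0#                                                            ∎)
    rows : Kernel M w
    rows i with i Fin.≟ r
    ... | yes ≡.refl = row-r
    ... | no i≢r = trans (reflexive (≡.cong row (≡.sym (Fin.punchIn-punchOut r≢i)))) (kw _)
      where r≢i = λ e → i≢r (≡.sym e)

  -- Invariance under transposition is obtained for kernels rather than for determinants. Rows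
  -- matter because the rows of the Moore matrix below belong to the elements whose dependence is in
  -- question.
  det≈0⇒rowRelation : ∀ n (M : Matrix n n) → det K n M ≈ 0# → ∃ λ v → Kernel (transpose M) v × Nonzero v
  det≈0⇒rowRelation n M e = let v , k , nz = det≈0⇒kernel n M e in kernel-transpose n (transpose M) v k nz

  rowRelation⇒det≈0 : ∀ n (M : Matrix n n) v → Kernel (transpose M) v → Nonzero v → det K n M ≈ 0#
  rowRelation⇒det≈0 n M v k nz = let w , kw , nzw = kernel-transpose n M v k nz in kernel⇒det≈0 n M w kw nzw

-- Finite fields

prime∣!⇒≤ : ∀ {p} → Prime p → ∀ m → p ∣ m ! → p ℕ.≤ m
prime∣!⇒≤ pr zero p∣ = contradiction (≡.subst Prime (ℕ.≤-antisym (∣⇒≤ p∣) (ℕ.>-nonZero⁻¹ _ {{prime⇒nonZero pr}})) pr) ¬prime[1]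
prime∣!⇒≤ pr (suc m) p∣ with euclidsLemma (suc m) (m !) pr p∣
... | inj₁ q = ∣⇒≤ q
... | inj₂ q = ℕ.m≤n⇒m≤1+n (prime∣!⇒≤ pr m q)

-- p divides p! = (p choose k) k! (p - k)!, but neither of the two factorials, whose arguments are
-- below p.
prime∣choose : ∀ {p k} → Prime p → 0 ℕ.< k → k ℕ.< p → p ∣ p choose k
prime∣choose {p} {k} pr 0<k k<p with euclidsLemma (p choose k) (k ! ℕ.* (p ℕ.∸ k) !) pr p∣product
  where
  instance
    _ = ℕ.m*n≢0 (k !) ((p ℕ.∸ k) !) {{k ℕ.!≢0}} {{(p ℕ.∸ k) ℕ.!≢0}}
  product≡p! : (p choose k) ℕ.* (k ! ℕ.* (p ℕ.∸ k) !) ≡ p !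
  product≡p! = ≡.trans (≡.cong (ℕ._* (k ! ℕ.* (p ℕ.∸ k) !)) (nCk≡n!/k![n-k]! (ℕ.<⇒≤ k<p)))
                       (m/n*n≡m (≡.subst (_∣ p !) (ℕ.*-comm ((p ℕ.∸ k) !) (k !)) ([n∸k]!k!∣n! (ℕ.<⇒≤ k<p))))
  p∣p! : ∀ {p} → Prime p → p ∣ p !
  p∣p! {zero} pr = contradiction (ℕ.>-nonZero⁻¹ _ {{prime⇒nonZero pr}}) (λ ())
  p∣p! {suc p} pr = divides (p !) (ℕ.*-comm (suc p) (p !))
  p∣product : p ∣ (p choose k) ℕ.* (k ! ℕ.* (p ℕ.∸ k) !)
  p∣product = ≡.subst (p ∣_) (≡.sym product≡p!) (p∣p! pr)
... | inj₁ q = q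
... | inj₂ q with euclidsLemma (k !) ((p ℕ.∸ k) !) pr q
...   | inj₁ r = contradiction (prime∣!⇒≤ pr k r) (ℕ.<⇒≱ k<p)
...   | inj₂ r = contradiction (prime∣!⇒≤ pr (p ℕ.∸ k) r) (ℕ.<⇒≱ (ℕ.∸-monoʳ-< 0<k (ℕ.<⇒≤ k<p)))

module FiniteFields {c ℓ} (K : CommutativeRing c ℓ) (isField : IsField K) {N} (card : HasCard K N) where
  open CommutativeRing K hiding (zero)
  open IsField isField
  open HasCard card
  open Algebra.Properties.Ring ring using (+-cancelʳ)
  open Algebra.Properties.Semiring.Mult semiring using (×-congʳ; ×1-homo-*; ×-assoc-*; ×-homo-1) renaming (_×_ to _·_)
  open Algebra.Properties.Semiring.Exp semiring using (^-assocʳ) renaming (_^_ to _^ᴷ_)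
  open Algebra.Properties.CommutativeSemiring.Exp commutativeSemiring using (^-distrib-*)
  open Algebra.Solver.Ring.NaturalCoefficients.Default commutativeSemiring using (solve; _:=_; _:+_; _:*_)
  open Relation.Binary.Reasoning.Setoid setoid

  index : Carrier → Fin N
  index x = proj₁ (enum-surj x)

  enum-index : ∀ x → enum (index x) ≈ x
  enum-index x = proj₂ (enum-surj x)

  index-cong : ∀ {x y} → x ≈ y → index x ≡ index y
  index-cong {x} {y} e = enum-inj _ _ (trans (enum-index x) (trans e (sym (enum-index y))))

  _≟_ : Decidable _≈_
  x ≟ y = map′ (λ e → trans (sym (enum-index x)) (trans (reflexive (≡.cong enum e)) (enum-index y)))
               index-cong (index x Fin.≟ index y)

  open Kernels K isField _≟_ public using (_≉0; x*y≈0⇒y≈0; *-≉0)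

  module _ {_∙_ ε} (isCommutativeMonoid : IsCommutativeMonoid _≈_ _∙_ ε) where
    private
      M : CommutativeMonoid c ℓ
      M = record { isCommutativeMonoid = isCommutativeMonoid }
    open Algebra.Properties.CommutativeMonoid.Sum M using (sum; sum-permute; sum-cong-≋)

    -- Stated for any commutative monoid on the carrier of K, since it serves twice: for sums under
    -- translation and for products under scaling.
    sum-bijection : (h : Carrier → Carrier) → (∀ {x y} → x ≈ y → h x ≈ h y) →
                    (f g : Carrier → Carrier) → (∀ {x y} → x ≈ y → f x ≈ f y) → (∀ {x y} → x ≈ y → g x ≈ g y) →
                    (∀ x → f (g x) ≈ x) → (∀ x → g (f x) ≈ x) →
                    sum (λ i → h (enum i)) ≈ sum (λ i → h (f (enum i)))
    sum-bijection h h-cong f g f-cong g-cong fg gf =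
      trans (sum-permute (λ i → h (enum i)) π) (sum-cong-≋ λ i → h-cong (enum-index (f (enum i))))
      where
      on : (Carrier → Carrier) → Fin N → Fin N
      on f i = index (f (enum i))
      inverse-on : ∀ f g → (∀ {x y} → x ≈ y → f x ≈ f y) → (∀ x → f (g x) ≈ x) → ∀ i → on f (on g i) ≡ i
      inverse-on f g f-cong fg i = enum-inj _ _ (trans (enum-index _) (trans (f-cong (enum-index _)) (fg (enum i))))
      π : Permutation′ N
      π = permutation (on f) (on g) (inverse-on f g f-cong fg) (inverse-on g f g-cong gf)

  -- Translation by 1 permutes K, so the sum of all elements equals itself plus N copies of 1.
  N·1≈0 : N · 1# ≈ 0#
  N·1≈0 = +-cancelʳ (sum enum) _ _ (begin
    N · 1# + sum enum                ≈⟨ +-congʳ (sum-replicate N) ⟨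
    sum {N} (λ _ → 1#) + sum enum    ≈⟨ ∑-distrib-+ (λ _ → 1#) enum ⟨
    sum (λ i → 1# + enum i)
      ≈⟨ sum-bijection +-isCommutativeMonoid (λ x → x) (λ e → e) (1# +_) (- 1# +_) +-congˡ +-congˡ
           (λ x → trans (sym (+-assoc _ _ _)) (trans (+-congʳ (-‿inverseʳ 1#)) (+-identityˡ x)))
           (λ x → trans (sym (+-assoc _ _ _)) (trans (+-congʳ (-‿inverseˡ 1#)) (+-identityˡ x))) ⟨
    sum enum                         ≈⟨ +-identityˡ _ ⟨
    0# + sum enum                    ∎)
    where open Algebra.Properties.CommutativeMonoid.Sum +-commutativeMonoid

  -- N · 1 = 0 is a product of m factors p · 1, and a field has no zero divisors.
  characteristic : ∀ p m → N ≡ p ℕ.^ m → p · 1# ≈ 0#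
  characteristic p m e = root m (trans (reflexive (≡.cong (_· 1#) (≡.sym e))) N·1≈0)
    where
    root : ∀ m → (p ℕ.^ m) · 1# ≈ 0# → p · 1# ≈ 0#
    root zero e = contradiction (trans (sym e) (×-homo-1 1#)) 0≉1
    root (suc m) e with (p · 1#) ≟ 0#
    ... | yes z = z
    ... | no nz = root m (x*y≈0⇒y≈0 nz (trans (sym (×1-homo-* p (p ℕ.^ m))) e))

  pow≡^ : ∀ x m → pow K x m ≡ x ^ᴷ m
  pow≡^ x zero = ≡.refl
  pow≡^ x (suc m) = ≡.cong (x *_) (pow≡^ x m)

  pow-cong : ∀ m {x y} → x ≈ y → pow K x m ≈ pow K y m
  pow-cong zero e = refl
  pow-cong (suc m) e = *-cong e (pow-cong m e)

  pow-* : ∀ m x y → pow K (x * y) m ≈ pow K x m * pow K y m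
  pow-* m x y rewrite pow≡^ (x * y) m | pow≡^ x m | pow≡^ y m = ^-distrib-* x y m

  pow-pow : ∀ x m n → pow K (pow K x m) n ≈ pow K x (m ℕ.* n)
  pow-pow x m n rewrite pow≡^ x m | pow≡^ (x ^ᴷ m) n | pow≡^ x (m ℕ.* n) = ^-assocʳ x m n

  module Frobenius (p m : ℕ) (pr : Prime p) (N≡ : N ≡ p ℕ.^ m) where
    p∣⇒·≈0 : ∀ {k} x → p ∣ k → k · x ≈ 0#
    p∣⇒·≈0 x (divides-refl j) = begin
      (j ℕ.* p) · x          ≈⟨ ×-congʳ (j ℕ.* p) (*-identityˡ x) ⟨
      (j ℕ.* p) · (1# * x)   ≈⟨ ×-assoc-* (j ℕ.* p) 1# x ⟨
      ((j ℕ.* p) · 1#) * x   ≈⟨ *-congʳ (×1-homo-* j p) ⟩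
      (j · 1#) * (p · 1#) * x ≈⟨ *-congʳ (trans (*-congˡ (characteristic p m N≡)) (zeroʳ _)) ⟩
      0# * x                 ≈⟨ zeroˡ x ⟩
      0#                     ∎

    -- The inner binomial coefficients are divisible by p. The prime is quantified anew, with the
    -- vanishing as a hypothesis, so that it can be matched as a successor.
    ^p-+ : ∀ p x y → Prime p → (∀ {k} z → p ∣ k → k · z ≈ 0#) → (x + y) ^ᴷ p ≈ x ^ᴷ p + y ^ᴷ p
    ^p-+ zero x y pr _ = contradiction (ℕ.>-nonZero⁻¹ _ {{prime⇒nonZero pr}}) (λ ())
    ^p-+ p@(suc p′) x y pr vanish = begin
      (x + y) ^ᴷ p                                              ≈⟨ theorem p x y ⟩
      t zero + sum (λ i → t (suc i))                           ≈⟨ +-congˡ (sum-init-last (λ i → t (suc i))) ⟩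
      t zero + (sum (λ i → t (suc (inject₁ i))) + t (suc (fromℕ p′)))
        ≈⟨ +-cong first (+-cong (trans (sum-cong-≋ middle) (sum-replicate-zero p′)) last-term) ⟩
      y ^ᴷ p + (0# + x ^ᴷ p)                                     ≈⟨ trans (+-congˡ (+-identityˡ _)) (+-comm _ _) ⟩
      x ^ᴷ p + y ^ᴷ p                                            ∎
      where
      open Algebra.Properties.CommutativeMonoid.Sum +-commutativeMonoid
      open Algebra.Properties.CommutativeSemiring.Binomial commutativeSemiring using (theorem; binomialTerm)
      t = binomialTerm x y p
      first : t zero ≈ y ^ᴷ p
      first = trans (+-identityʳ _) (*-identityˡ _)
      middle : ∀ i → t (suc (inject₁ i)) ≈ 0#
      middle i = vanish _ (prime∣choose pr ℕ.z<s (ℕ.s<s (≡.subst (ℕ._< p′) (≡.sym (Fin.toℕ-inject₁ i)) (Fin.toℕ<n i))))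
      last-term : t (suc (fromℕ p′)) ≈ x ^ᴷ p
      last-term rewrite Fin.toℕ-fromℕ p′ | nCn≡1 p | ℕ.n∸n≡0 p′ = trans (+-identityʳ _) (*-identityʳ _)

    pow-+ : ∀ j x y → pow K (x + y) (p ℕ.^ j) ≈ pow K x (p ℕ.^ j) + pow K y (p ℕ.^ j)
    pow-+ zero x y = trans (*-identityʳ _) (sym (+-cong (*-identityʳ x) (*-identityʳ y)))
    pow-+ (suc j) x y = begin
      pow K (x + y) (p ℕ.* p ℕ.^ j)                ≈⟨ pow-pow (x + y) p (p ℕ.^ j) ⟨
      pow K (pow K (x + y) p) (p ℕ.^ j)            ≈⟨ pow-cong (p ℕ.^ j) base ⟩
      pow K (pow K x p + pow K y p) (p ℕ.^ j)      ≈⟨ pow-+ j _ _ ⟩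
      pow K (pow K x p) (p ℕ.^ j) + pow K (pow K y p) (p ℕ.^ j)
        ≈⟨ +-cong (pow-pow x p (p ℕ.^ j)) (pow-pow y p (p ℕ.^ j)) ⟩
      pow K x (p ℕ.* p ℕ.^ j) + pow K y (p ℕ.* p ℕ.^ j) ∎
      where
      base : pow K (x + y) p ≈ pow K x p + pow K y p
      base rewrite pow≡^ (x + y) p | pow≡^ x p | pow≡^ y p = ^p-+ p x y pr p∣⇒·≈0

  -- Multiplication by u ≠ 0 permutes K. To let the product range over all of K, zero is first
  -- replaced by one.
  pow-card : ∀ u → pow K u N ≈ u
  pow-card u with u ≟ 0#
  -- `index 0#` witnesses N > 0; for N = 0 the power would be 1.
  ... | yes u≈0 = trans (pow-cong N u≈0) (trans (zero-pow N (index 0#)) (sym u≈0))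
    where
    zero-pow : ∀ n → Fin n → pow K 0# n ≈ 0#
    zero-pow (suc n) _ = zeroˡ _
  ... | no u≉0 = begin
    pow K u N                    ≈⟨ u*∏ N (λ i → ψ (enum i)) (index 0#) (ψ-zero (enum-index 0#)) (λ i i≢ → ψ-nonzero λ e →
                                      i≢ (enum-inj _ _ (trans e (sym (enum-index 0#))))) ⟨
    u * ∏ (λ i → ψ (enum i))     ≈⟨ *-congˡ ∏ψ≈1 ⟩
    u * 1#                       ≈⟨ *-identityʳ u ⟩
    u                            ∎
    where
    open Algebra.Properties.CommutativeMonoid.Sum *-commutativeMonoid
      using (sum-remove; ∑-distrib-+; sum-cong-≋; sum-replicate) renaming (sum to ∏)
    u⁻¹ = proj₁ (inverse u u≉0)
    uu⁻¹ = proj₂ (inverse u u≉0)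
    φ ψ : Carrier → Carrier
    φ x with x ≟ 0#
    ... | yes _ = 1#
    ... | no _ = x
    -- `ψ x` is the factor by which `φ` changes when x is multiplied by u. It is u except at zero,
    -- so its product over K is u^(N-1), and invariance of the product of `φ` makes it 1.
    ψ x with x ≟ 0#
    ... | yes _ = 1#
    ... | no _ = u
    ψ-zero : ∀ {x} → x ≈ 0# → ψ x ≈ 1#
    ψ-zero {x} e with x ≟ 0#
    ... | yes _ = refl
    ... | no p = contradiction e p
    ψ-nonzero : ∀ {x} → x ≉0 → ψ x ≈ u
    ψ-nonzero {x} e with x ≟ 0#
    ... | yes p = contradiction p e
    ... | no _ = refl
    φ-cong : ∀ {x y} → x ≈ y → φ x ≈ φ y
    φ-cong {x} {y} e with x ≟ 0# | y ≟ 0#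
    ... | yes _ | yes _ = refl
    ... | yes p | no q = contradiction (trans (sym e) p) q
    ... | no p | yes q = contradiction (trans e q) p
    ... | no _ | no _ = e
    φ-nonzero : ∀ x → φ x ≉0
    φ-nonzero x with x ≟ 0#
    ... | yes _ = λ e → 0≉1 (sym e)
    ... | no p = p
    φ-* : ∀ x → φ (u * x) ≈ ψ x * φ x
    φ-* x with (u * x) ≟ 0# | x ≟ 0#
    ... | yes _ | yes _ = sym (*-identityˡ 1#)
    ... | yes p | no q = contradiction (x*y≈0⇒y≈0 u≉0 p) q
    ... | no p | yes q = contradiction (trans (*-congˡ q) (zeroʳ u)) p
    ... | no _ | no _ = refl
    ∏-nonzero : ∀ {n} (f : Fin n → Carrier) → (∀ i → f i ≉0) → ∏ f ≉0
    ∏-nonzero {zero} f nz e = 0≉1 (sym e)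
    ∏-nonzero {suc n} f nz = *-≉0 (nz zero) (∏-nonzero (λ i → f (suc i)) (λ i → nz (suc i)))
    u*∏ : ∀ n (f : Fin n → Carrier) i₀ → f i₀ ≈ 1# → (∀ i → i ≢ i₀ → f i ≈ u) → u * ∏ f ≈ pow K u n
    u*∏ (suc n) f i₀ e₀ e = *-congˡ (trans (sum-remove f) (trans (*-cong e₀ rest) (*-identityˡ _)))
      where
      rest : ∏ (λ i → f (punchIn i₀ i)) ≈ pow K u n
      rest = trans (sum-cong-≋ λ i → e _ (Fin.punchInᵢ≢i i₀ i))
                   (trans (sum-replicate n) (reflexive (≡.sym (pow≡^ u n))))
    Φ = ∏ (λ i → φ (enum i))
    Ψ = ∏ (λ i → ψ (enum i))
    inverses : ∀ v w → v * w ≈ 1# → ∀ x → v * (w * x) ≈ x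
    inverses v w e x = trans (sym (*-assoc v w x)) (trans (*-congʳ e) (*-identityˡ x))
    ΨΦ≈Φ : Ψ * Φ ≈ Φ
    ΨΦ≈Φ = begin
      Ψ * Φ                                  ≈⟨ ∑-distrib-+ (λ i → ψ (enum i)) (λ i → φ (enum i)) ⟨
      ∏ (λ i → ψ (enum i) * φ (enum i))      ≈⟨ sum-cong-≋ (λ i → φ-* (enum i)) ⟨
      ∏ (λ i → φ (u * enum i))
        ≈⟨ sum-bijection *-isCommutativeMonoid φ φ-cong (u *_) (u⁻¹ *_) *-congˡ *-congˡ
             (inverses u u⁻¹ uu⁻¹) (inverses u⁻¹ u (trans (*-comm _ _) uu⁻¹)) ⟨
      Φ                                      ∎
    ∏ψ≈1 : Ψ ≈ 1#
    ∏ψ≈1 = begin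
      Ψ                   ≈⟨ *-identityʳ Ψ ⟨
      Ψ * 1#              ≈⟨ *-congˡ ΦΦ⁻¹ ⟨
      Ψ * (Φ * Φ⁻¹)       ≈⟨ *-assoc _ _ _ ⟨
      Ψ * Φ * Φ⁻¹         ≈⟨ *-congʳ ΨΦ≈Φ ⟩
      Φ * Φ⁻¹             ≈⟨ ΦΦ⁻¹ ⟩
      1#                  ∎
      where
      Φ≉0 = ∏-nonzero (λ i → φ (enum i)) (λ i → φ-nonzero (enum i))
      Φ⁻¹ = proj₁ (inverse Φ Φ≉0)
      ΦΦ⁻¹ = proj₂ (inverse Φ Φ≉0)

  -- Polynomial functions of degree ≤ d with x^d-coefficient a, characterised by their difference
  -- quotients so that no coefficient lists are needed.
  IsPolynomial : ℕ → Carrier → (Carrier → Carrier) → Set _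
  IsPolynomial zero a φ = ∀ x → φ x ≈ a
  IsPolynomial (suc d) a φ = ∀ r → ∃ λ χ → IsPolynomial d a χ × (∀ x → φ x ≈ (x + - r) * χ x + φ r)

  poly-resp : ∀ d {a φ ψ} → (∀ x → φ x ≈ ψ x) → IsPolynomial d a φ → IsPolynomial d a ψ
  poly-resp zero e f x = trans (sym (e x)) (f x)
  poly-resp (suc d) e f r = let χ , p , q = f r in χ , p , λ x → trans (sym (e x)) (trans (q x) (+-congˡ (e r)))

  poly-respˡ : ∀ d {a b φ} → a ≈ b → IsPolynomial d a φ → IsPolynomial d b φ
  poly-respˡ zero e f x = trans (f x) e
  poly-respˡ (suc d) e f r = let χ , p , q = f r in χ , poly-respˡ d e p , q

  poly-+ : ∀ d {a b φ ψ} → IsPolynomial d a φ → IsPolynomial d b ψ → IsPolynomial d (a + b) (λ x → φ x + ψ x)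
  poly-+ zero f g x = +-cong (f x) (g x)
  poly-+ (suc d) f g r =
    let χ , p , q = f r
        χ′ , p′ , q′ = g r
    in (λ x → χ x + χ′ x) , poly-+ d p p′ , λ x → trans (+-cong (q x) (q′ x))
         (solve 5 (λ y u v a b → y :* u :+ a :+ (y :* v :+ b) := y :* (u :+ v) :+ (a :+ b)) refl
           (x + - r) (χ x) (χ′ x) _ _)

  poly-* : ∀ d b {a φ} → IsPolynomial d a φ → IsPolynomial d (b * a) (λ x → b * φ x)
  poly-* zero b f x = *-congˡ (f x)
  poly-* (suc d) b f r =
    let χ , p , q = f r
    in (λ x → b * χ x) , poly-* d b p , λ x → trans (*-congˡ (q x))
         (solve 4 (λ b y u a → b :* (y :* u :+ a) := y :* (b :* u) :+ b :* a) refl b (x + - r) (χ x) _)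

  poly-0 : ∀ d → IsPolynomial d 0# (λ _ → 0#)
  poly-0 zero x = refl
  poly-0 (suc d) r = (λ _ → 0#) , poly-0 d , λ x → sym (trans (+-identityʳ _) (zeroʳ _))

  poly-weaken : ∀ d {a φ} → IsPolynomial d a φ → IsPolynomial (suc d) 0# φ
  poly-weaken zero f r = (λ _ → 0#) , (λ _ → refl) , λ x →
    trans (f x) (trans (sym (f r)) (sym (trans (+-congʳ (zeroʳ _)) (+-identityˡ _))))
  poly-weaken (suc d) f r = let χ , p , q = f r in χ , poly-weaken d p , q

  poly-weaken< : ∀ {d d′ a φ} → d ℕ.< d′ → IsPolynomial d a φ → IsPolynomial d′ 0# φ
  poly-weaken< {d} d<d′ f with ℕ.m≤n⇒∃[o]m+o≡n d<d′
  ... | o , ≡.refl = go o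
    where
    go : ∀ o → IsPolynomial (suc d ℕ.+ o) 0# _
    go zero rewrite ℕ.+-identityʳ d = poly-weaken d f
    go (suc o) rewrite ℕ.+-suc d o = poly-weaken (suc d ℕ.+ o) (go o)

  x-r+r : ∀ x r → x ≈ (x + - r) + r
  x-r+r x r = sym (trans (+-assoc _ _ _) (trans (+-congˡ (-‿inverseˡ r)) (+-identityʳ x)))

  poly-pow : ∀ d → IsPolynomial d 1# (λ x → pow K x d)
  poly-pow zero x = refl
  poly-pow (suc zero) r = (λ _ → 1#) , (λ _ → refl) , λ x →
    trans (*-identityʳ x) (trans (x-r+r x r) (sym (+-cong (*-identityʳ _) (*-identityʳ r))))
  poly-pow (suc (suc d)) r =
    let χ , p , q = poly-pow (suc d) r
    -- x^(d+2) - r^(d+2) = (x - r)(x^(d+1) + r χ(x)), where χ is the quotient for exponent d+1. The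
    -- summand r χ has lower degree and leaves the top coefficient at 1.
    in (λ x → pow K x (suc d) + r * χ x) ,
       poly-respˡ (suc d) (+-identityʳ 1#) (poly-+ (suc d) (poly-pow (suc d))
         (poly-respˡ (suc d) (zeroʳ r) (poly-* (suc d) r (poly-weaken d p)))) ,
       λ x → begin
         x * pow K x (suc d)                             ≈⟨ *-congʳ (x-r+r x r) ⟩
         ((x + - r) + r) * pow K x (suc d)               ≈⟨ distribʳ _ _ _ ⟩
         (x + - r) * pow K x (suc d) + r * pow K x (suc d) ≈⟨ +-congˡ (*-congˡ (q x)) ⟩
         (x + - r) * pow K x (suc d) + r * ((x + - r) * χ x + pow K r (suc d))
           ≈⟨ solve 5 (λ y f r u g → y :* f :+ r :* (y :* u :+ g) := y :* (f :+ r :* u) :+ r :* g) refl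
                (x + - r) (pow K x (suc d)) r (χ x) (pow K r (suc d)) ⟩
         (x + - r) * (pow K x (suc d) + r * χ x) + r * pow K r (suc d) ∎

  -- The difference quotient at one root vanishes at all the others. After d of these steps only the
  -- constant `a` is left, and one root remains at which it vanishes.
  roots : ∀ d {a φ} → IsPolynomial d a φ → (ρ : Fin (suc d) → Carrier) → (∀ i j → ρ i ≈ ρ j → i ≡ j) →
          (∀ i → φ (ρ i) ≈ 0#) → a ≈ 0#
  roots zero f ρ inj z = trans (sym (f (ρ zero))) (z zero)
  roots (suc d) {φ = φ} f ρ inj z =
    let χ , p , q = f (ρ zero)
    in roots d p (λ i → ρ (suc i)) (λ i j e → Fin.suc-injective (inj _ _ e)) λ i →
         x*y≈0⇒y≈0 {ρ (suc i) + - ρ zero} (λ e → contradiction (inj (suc i) zero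
             (trans (x-r+r _ (ρ zero)) (trans (+-congʳ e) (+-identityˡ _)))) λ ())
           (begin
             (ρ (suc i) + - ρ zero) * χ (ρ (suc i))                 ≈⟨ +-identityʳ _ ⟨
             (ρ (suc i) + - ρ zero) * χ (ρ (suc i)) + 0#            ≈⟨ +-congˡ (z zero) ⟨
             (ρ (suc i) + - ρ zero) * χ (ρ (suc i)) + φ (ρ zero)    ≈⟨ q (ρ (suc i)) ⟨
             φ (ρ (suc i))                                          ≈⟨ z (suc i) ⟩
             0#                                                     ∎)

  vanishing-polynomial : ∀ {d a φ} → IsPolynomial d a φ → d ℕ.< N → (∀ x → φ x ≈ 0#) → a ≈ 0#
  vanishing-polynomial {d} f d<N z = roots d f (λ i → enum (Fin.inject≤ i d<N))
    (λ i j e → Fin.inject≤-injective d<N d<N i j (enum-inj _ _ e)) (λ i → z _)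

PowerAdditive : ∀ {c ℓ} → CommutativeRing c ℓ → ℕ → Set _
PowerAdditive K q = ∀ x y → pow K (x + y) q ≈ pow K x q + pow K y q
  where open CommutativeRing K using (_+_; _≈_)

-- `A` is not assumed decidable, so only the absence of a least witness can be refuted: by strong
-- induction it would exclude every witness.
least : ∀ {a} (A : ℕ → Set a) d → A d → ¬ ¬ (∃ λ m → A m × (∀ i → i ℕ.< m → ¬ A i))
least A d a none = <-rec (λ d → ¬ A d) (λ d ih a → none (d , a , λ _ i<d → ih i<d)) d a

-- Polynomials in the Frobenius

module FrobeniusPolynomials {c ℓ} (K : CommutativeRing c ℓ) (isField : IsField K) (q n : ℕ)
  (card : HasCard K (q ℕ.^ n)) (1<q : 1 ℕ.< q) (1≤n : 1 ℕ.≤ n)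
  (frobenius-+ : PowerAdditive K q) where
  open CommutativeRing K hiding (zero)
  open IsField isField
  open HasCard card using (enum)
  open FiniteFields K isField card public
  open Determinants K public
  open Kernels K isField _≟_ public using (Nonzero; allZero?; det≈0⇒rowRelation; rowRelation⇒det≈0)
  open Algebra.Properties.Ring ring using (-0#≈0#; -1*x≈-x; +-inverseʳ-unique)
  open Algebra.Solver.Ring.NaturalCoefficients.Default commutativeSemiring using (solve; _:=_; _:+_; _:*_)
  open Relation.Binary.Reasoning.Setoid setoid

  -- `s i` is the power σ^i. It is sealed so that x^(q^i) stays symbolic during unification.
  opaque
    s : ℕ → Carrier → Carrier
    s i x = pow K x (q ℕ.^ i)

    s≡pow : ∀ i x → s i x ≡ pow K x (q ℕ.^ i)
    s≡pow i x = ≡.refl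

    s-cong : ∀ i {x y} → x ≈ y → s i x ≈ s i y
    s-cong i = pow-cong (q ℕ.^ i)

    s-* : ∀ i x y → s i (x * y) ≈ s i x * s i y
    s-* i = pow-* (q ℕ.^ i)

    s-zero : ∀ x → s 0 x ≈ x
    s-zero = *-identityʳ

    s-s : ∀ i j x → s i (s j x) ≈ s (i ℕ.+ j) x
    s-s i j x = trans (pow-pow x (q ℕ.^ j) (q ℕ.^ i))
      (reflexive (≡.cong (pow K x) (≡.trans (ℕ.*-comm (q ℕ.^ j) (q ℕ.^ i)) (≡.sym (ℕ.^-distribˡ-+-* q i j)))))

    s-n : ∀ x → s n x ≈ x
    s-n = pow-card

    s-+ : ∀ i x y → s i (x + y) ≈ s i x + s i y
    s-+ zero x y = trans (*-identityʳ _) (sym (+-cong (*-identityʳ x) (*-identityʳ y)))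
    s-+ (suc i) x y = begin
      pow K (x + y) (q ℕ.* q ℕ.^ i)             ≈⟨ pow-pow (x + y) q (q ℕ.^ i) ⟨
      s i (pow K (x + y) q)                     ≈⟨ s-cong i (frobenius-+ x y) ⟩
      s i (pow K x q + pow K y q)               ≈⟨ s-+ i _ _ ⟩
      s i (pow K x q) + s i (pow K y q)         ≈⟨ +-cong (pow-pow x q (q ℕ.^ i)) (pow-pow y q (q ℕ.^ i)) ⟩
      s (suc i) x + s (suc i) y                 ∎

    s-0# : ∀ i → s i 0# ≈ 0#
    s-0# i with ℕ.suc-pred (q ℕ.^ i) {{ℕ.m^n≢0 q i {{ℕ.>-nonZero (ℕ.<-trans ℕ.z<s 1<q)}}}}
    ... | e = trans (reflexive (≡.cong (pow K 0#) (≡.sym e))) (zeroˡ _)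

    s-1# : ∀ i → s i 1# ≈ 1#
    s-1# i = go (q ℕ.^ i)
      where
      go : ∀ m → pow K 1# m ≈ 1#
      go zero = refl
      go (suc m) = trans (*-identityˡ _) (go m)

    poly-s : ∀ i → IsPolynomial (q ℕ.^ i) 1# (s i)
    poly-s i = poly-pow (q ℕ.^ i)

  s-neg : ∀ i x → s i (- x) ≈ - s i x
  s-neg i x = +-inverseʳ-unique _ _ (trans (sym (s-+ i x (- x))) (trans (s-cong i (-‿inverseʳ x)) (s-0# i)))

  s-comm : ∀ i j x → s i (s j x) ≈ s j (s i x)
  s-comm i j x = trans (s-s i j x) (trans (reflexive (≡.cong (λ m → s m x) (ℕ.+-comm i j))) (sym (s-s j i x)))

  s-∑ : ∀ {m} j (f : Fin m → Carrier) → s j (∑ f) ≈ ∑ (λ i → s j (f i))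
  s-∑ {zero} j f = trans (s-cong j (∑-empty f)) (trans (s-0# j) (sym (∑-empty _)))
  s-∑ {suc m} j f = trans (s-cong j (∑-suc f)) (trans (s-+ j _ _)
    (trans (+-congˡ (s-∑ j (λ i → f (suc i)))) (sym (∑-suc _))))

  -- As σ^n is the identity, σ^(n-1) inverts σ; n ≥ 1 makes the truncated subtraction exact.
  s⁻¹ : Carrier → Carrier
  s⁻¹ = s (n ∸ 1)

  s⁻¹-s : ∀ x → s⁻¹ (s 1 x) ≈ x
  s⁻¹-s x = trans (s-s (n ∸ 1) 1 x) (trans (reflexive (≡.cong (λ m → s m x) (ℕ.m∸n+n≡m 1≤n))) (s-n x))

  s-s⁻¹ : ∀ x → s 1 (s⁻¹ x) ≈ x
  s-s⁻¹ x = trans (s-comm 1 (n ∸ 1) x) (s⁻¹-s x)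

  Fq : Carrier → Set ℓ
  Fq x = s 1 x ≈ x

  Fq-resp : ∀ {x y} → x ≈ y → Fq x → Fq y
  Fq-resp e f = trans (s-cong 1 (sym e)) (trans f e)

  Fq-0# : Fq 0#
  Fq-0# = s-0# 1

  Fq-1# : Fq 1#
  Fq-1# = s-1# 1

  Fq-+ : ∀ {x y} → Fq x → Fq y → Fq (x + y)
  Fq-+ f g = trans (s-+ 1 _ _) (+-cong f g)

  Fq-* : ∀ {x y} → Fq x → Fq y → Fq (x * y)
  Fq-* f g = trans (s-* 1 _ _) (*-cong f g)

  Fq-neg : ∀ {x} → Fq x → Fq (- x)
  Fq-neg f = trans (s-neg 1 _) (-‿cong f)

  Fq-inverse : ∀ {x y} → x * y ≈ 1# → Fq x → Fq y
  Fq-inverse {x} {y} e f = begin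
    s 1 y                ≈⟨ *-identityˡ _ ⟨
    1# * s 1 y           ≈⟨ *-congʳ e ⟨
    x * y * s 1 y        ≈⟨ solve 3 (λ x y z → x :* y :* z := y :* (x :* z)) refl x y (s 1 y) ⟩
    y * (x * s 1 y)      ≈⟨ *-congˡ (*-congʳ f) ⟨
    y * (s 1 x * s 1 y)  ≈⟨ *-congˡ (trans (sym (s-* 1 x y)) (trans (s-cong 1 e) (s-1# 1))) ⟩
    y * 1#               ≈⟨ *-identityʳ y ⟩
    y                    ∎

  Fq-s : ∀ i {x} → Fq x → s i x ≈ x
  Fq-s zero f = s-zero _
  Fq-s (suc i) {x} f = trans (sym (s-s 1 i x)) (trans (s-cong 1 (Fq-s i f)) f)

  -- Linear dependence over F_q and Moore determinants

  Dependent : ∀ {m} → (Fin m → Carrier) → Set _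
  Dependent t = ∃ λ f → (∀ i → Fq (f i)) × Nonzero f × ∑ (λ i → f i * t i) ≈ 0#

  dependent-suc : ∀ {m} (t : Fin (suc m) → Carrier) → Dependent (λ i → t (suc i)) → Dependent t
  dependent-suc {m} t (f , fq , (i , p) , e) = f′ , fq′ , (suc i , p) ,
    trans (∑-suc _) (trans (+-cong (zeroˡ _) e) (+-identityˡ 0#))
    where
    f′ : Fin (suc m) → Carrier
    f′ zero = 0#
    f′ (suc i) = f i
    fq′ : ∀ i → Fq (f′ i)
    fq′ zero = Fq-0#
    fq′ (suc i) = fq i

  -- Once a relation is normalised to c₀ = 1, its difference with its Frobenius twist is a shorter
  -- relation, trivial exactly when all coefficients lie in F_q.
  moore-dependent : ∀ m (t c : Fin m → Carrier) → Nonzero c →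
                    (∀ j → j ℕ.< m → ∑ (λ i → c i * s j (t i)) ≈ 0#) → Dependent t
  moore-dependent (suc m) t c (i , ci≉0) rel with c zero ≟ 0#
  ... | yes c₀≈0 = dependent-suc t (moore-dependent m (λ i → t (suc i)) (λ i → c (suc i)) (nonzero i ci≉0) λ j j<m →
          trans (sym (trans (∑-suc _) (trans (+-congʳ (trans (*-congʳ c₀≈0) (zeroˡ _))) (+-identityˡ _))))
                (rel j (ℕ.m<n⇒m<1+n j<m)))
    where
    nonzero : ∀ i → c i ≉0 → Nonzero (λ i → c (suc i))
    nonzero zero p = contradiction c₀≈0 p
    nonzero (suc i) p = i , p
  ... | no c₀≉0 = result
    where
    u = proj₁ (inverse (c zero) c₀≉0)
    b d : Fin (suc m) → Carrier
    b i = u * c i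
    d i = s 1 (b i) + - 1# * b i
    b₀≈1 : b zero ≈ 1#
    b₀≈1 = trans (*-comm _ _) (proj₂ (inverse (c zero) c₀≉0))
    x-x : ∀ {x y} → x ≈ y → x + - 1# * y ≈ 0#
    x-x e = trans (+-cong e (-1*x≈-x _)) (-‿inverseʳ _)
    x-x⁻¹ : ∀ {x y} → x + - 1# * y ≈ 0# → x ≈ y
    x-x⁻¹ {x} {y} e = trans (x-r+r x y) (trans (+-congʳ (trans (+-congˡ (sym (-1*x≈-x y))) e)) (+-identityˡ y))
    d₀≈0 : d zero ≈ 0#
    d₀≈0 = x-x (trans (s-cong 1 b₀≈1) (trans Fq-1# (sym b₀≈1)))
    rel-b : ∀ j → j ℕ.< suc m → ∑ (λ i → b i * s j (t i)) ≈ 0#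
    rel-b j j<m = trans (∑-cong λ i → *-assoc _ _ _) (trans (sym (∑-*ˡ u _)) (trans (*-congˡ (rel j j<m)) (zeroʳ u)))
    -- σ applied to relation j involves the same elements σ^(j+1) tᵢ as relation j+1, so the two can
    -- be subtracted. One relation is lost, but so is one element, because `d zero` vanishes.
    rel-d : ∀ j → j ℕ.< m → ∑ (λ i → d i * s (suc j) (t i)) ≈ 0#
    rel-d j j<m = begin
      ∑ (λ i → d i * s (suc j) (t i))
        ≈⟨ ∑-cong (λ i → trans (solve 4 (λ x o y z → (x :+ o :* y) :* z := x :* z :+ o :* (y :* z)) refl
             (s 1 (b i)) (- 1#) (b i) (s (suc j) (t i))) (+-congʳ (trans (*-congˡ (sym (s-s 1 j (t i)))) (sym (s-* 1 _ _))))) ⟩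
      ∑ (λ i → s 1 (b i * s j (t i)) + - 1# * (b i * s (suc j) (t i)))
        ≈⟨ trans (∑-+ _ _) (+-cong (sym (s-∑ 1 _)) (sym (∑-*ˡ (- 1#) _))) ⟩
      s 1 (∑ (λ i → b i * s j (t i))) + - 1# * ∑ (λ i → b i * s (suc j) (t i))
        ≈⟨ +-cong (trans (s-cong 1 (rel-b j (ℕ.m<n⇒m<1+n j<m))) (s-0# 1)) (trans (*-congˡ (rel-b (suc j) (ℕ.s<s j<m))) (zeroʳ _)) ⟩
      0# + 0#  ≈⟨ +-identityˡ 0# ⟩
      0#       ∎
    result : Dependent t
    result with allZero? (λ i → d (suc i))
    ... | inj₁ z = b , fixed , (zero , λ e → 0≉1 (trans (sym e) b₀≈1)) ,
            trans (∑-cong λ i → *-congˡ (sym (s-zero (t i)))) (rel-b 0 ℕ.z<s)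
      where
      fixed : ∀ i → Fq (b i)
      fixed zero = x-x⁻¹ d₀≈0
      fixed (suc i) = x-x⁻¹ (z i)
    -- The relations for `d` begin with σ instead of the identity. Applying σ⁻¹ to them,
    -- coefficients included, shifts them back to the form that the induction expects.
    ... | inj₂ (i , p) = dependent-suc t (moore-dependent m (λ i → t (suc i)) (λ i → s⁻¹ (d (suc i)))
            (i , λ e → p (trans (sym (s-s⁻¹ _)) (trans (s-cong 1 e) (s-0# 1)))) λ j j<m → begin
              ∑ (λ i → s⁻¹ (d (suc i)) * s j (t (suc i)))
                ≈⟨ ∑-cong (λ i → trans (*-congˡ (sym (trans (s-cong (n ∸ 1) (sym (s-s 1 j _))) (s⁻¹-s _)))) (sym (s-* (n ∸ 1) _ _))) ⟩
              ∑ (λ i → s⁻¹ (d (suc i) * s (suc j) (t (suc i))))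
                ≈⟨ s-∑ (n ∸ 1) _ ⟨
              s⁻¹ (∑ (λ i → d (suc i) * s (suc j) (t (suc i))))
                ≈⟨ s-cong (n ∸ 1) (trans (sym (trans (∑-suc _) (trans (+-congʳ (trans (*-congʳ d₀≈0) (zeroˡ _))) (+-identityˡ _)))) (rel-d j j<m)) ⟩
              s⁻¹ 0#  ≈⟨ s-0# (n ∸ 1) ⟩
              0#      ∎)

  -- The transpose of the usual Moore matrix, with one row for each element.
  mooreMatrix : ∀ {m} → (Fin m → Carrier) → Matrix m m
  mooreMatrix t i j = s (toℕ j) (t i)

  det≈0⇒dependent : ∀ m (t : Fin m → Carrier) → det K m (mooreMatrix t) ≈ 0# → Dependent t
  det≈0⇒dependent m t e =
    let v , k , nz = det≈0⇒rowRelation m (mooreMatrix t) e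
    in moore-dependent m t v nz λ j j<m → trans (∑-cong λ i → trans (*-comm _ _)
         (*-congʳ (reflexive (≡.cong (λ j → s j (t i)) (≡.sym (Fin.toℕ-fromℕ< j<m)))))) (k (Fin.fromℕ< j<m))

  -- Coefficients in F_q are fixed by every σʲ, so one relation among the elements gives the same
  -- relation in each column.
  dependent⇒det≈0 : ∀ m (t : Fin m → Carrier) → Dependent t → det K m (mooreMatrix t) ≈ 0#
  dependent⇒det≈0 m t (f , fq , nz , e) = rowRelation⇒det≈0 m (mooreMatrix t) f (λ j → begin
    ∑ (λ i → s (toℕ j) (t i) * f i)   ≈⟨ ∑-cong (λ i → trans (*-congˡ (sym (Fq-s (toℕ j) (fq i)))) (trans (*-comm _ _) (sym (s-* (toℕ j) _ _)))) ⟩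
    ∑ (λ i → s (toℕ j) (f i * t i))   ≈⟨ s-∑ (toℕ j) _ ⟨
    s (toℕ j) (∑ (λ i → f i * t i))   ≈⟨ trans (s-cong (toℕ j) e) (s-0# (toℕ j)) ⟩
    0#                                ∎) nz

  -- Coefficient sequences: degree bounds, products and division

  Seq : Set c
  Seq = ℕ → Carrier

  infix 4 _≺_ _≋_
  -- A strict degree bound, so that `F ≺ 0` expresses F = 0.
  _≺_ : Seq → ℕ → Set ℓ
  F ≺ N = ∀ i → N ℕ.≤ i → F i ≈ 0#

  _≋_ : Seq → Seq → Set ℓ
  F ≋ G = ∀ i → F i ≈ G i

  Over : Seq → Set ℓ
  Over F = ∀ i → Fq (F i)

  tail : Seq → Seq
  tail F i = F (suc i)

  infixl 7 _⊛_
  _⊛_ : Seq → Seq → Seq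
  _⊛_ = mulCoeff K

  Monic : ℕ → Seq → Set ℓ
  Monic k F = F k ≈ 1# × F ≺ suc k

  sumUpTo-cong : ∀ m {f g : Seq} → (∀ i → i ℕ.≤ m → f i ≈ g i) → sumUpTo K m f ≈ sumUpTo K m g
  sumUpTo-cong zero e = e 0 ℕ.z≤n
  sumUpTo-cong (suc m) e = +-cong (sumUpTo-cong m λ i i≤m → e i (ℕ.m≤n⇒m≤1+n i≤m)) (e (suc m) ℕ.≤-refl)

  -- A coefficient of F G = G₀ F + X F (tail G). The lemmas on products recurse on the second factor
  -- through this identity.
  ⊛-suc : ∀ F G m → (F ⊛ G) (suc m) ≈ F (suc m) * G 0 + (F ⊛ tail G) m
  ⊛-suc F G m = trans (+-cong
      (sumUpTo-cong m λ i i≤m → *-congˡ (reflexive (≡.cong G (ℕ.+-∸-assoc 1 i≤m))))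
      (*-congˡ (reflexive (≡.cong G (ℕ.n∸n≡0 m)))))
    (+-comm _ _)

  ⊛-congˡ : ∀ F {G H} → G ≋ H → F ⊛ G ≋ F ⊛ H
  ⊛-congˡ F e m = sumUpTo-cong m λ i _ → *-congˡ (e (m ∸ i))

  ⊛-congʳ : ∀ {F G} H → F ≋ G → F ⊛ H ≋ G ⊛ H
  ⊛-congʳ H e m = sumUpTo-cong m λ i _ → *-congʳ (e i)

  ⊛-over : ∀ {F G} → Over F → Over G → Over (F ⊛ G)
  ⊛-over f g zero = Fq-* (f 0) (g 0)
  ⊛-over {F} {G} f g (suc m) = Fq-resp (sym (⊛-suc F G m))
    (Fq-+ (Fq-* (f (suc m)) (g 0)) (⊛-over f (λ i → g (suc i)) m))

  ⊛-zeroʳ : ∀ F {G} → G ≺ 0 → F ⊛ G ≺ 0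
  ⊛-zeroʳ F {G} g i _ = trans (⊛-congˡ F (λ j → g j ℕ.z≤n) i) (zeros i)
    where
    zeros : ∀ i → (F ⊛ (λ _ → 0#)) i ≈ 0#
    zeros zero = zeroʳ _
    zeros (suc i) = trans (⊛-suc F (λ _ → 0#) i) (trans (+-cong (zeroʳ _) (zeros i)) (+-identityˡ 0#))

  ⊛-≺ : ∀ {k M F G} → F ≺ suc k → G ≺ M → F ⊛ G ≺ k ℕ.+ M
  ⊛-≺ {k} {zero} {F} {G} f g i _ = ⊛-zeroʳ F g i ℕ.z≤n
  ⊛-≺ {k} {suc M} {F} {G} f g i k+M<i with ≡.subst (ℕ._≤ i) (ℕ.+-suc k M) k+M<i
  ⊛-≺ {k} {suc M} {F} {G} f g (suc i) _ | ℕ.s≤s k+M≤i = trans (⊛-suc F G i)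
    (trans (+-cong (trans (*-congʳ (f (suc i) (ℕ.s≤s (ℕ.≤-trans (ℕ.m≤m+n k M) k+M≤i)))) (zeroˡ _))
                   (⊛-≺ f (λ j M≤j → g (suc j) (ℕ.s≤s M≤j)) i k+M≤i))
           (+-identityˡ 0#))

  -- Nothing is assumed of `G t`, so that the equation can be read backwards: a vanishing
  -- coefficient of the product forces one of G to vanish.
  ⊛-lead : ∀ {k F G} t → Monic k F → G ≺ suc t → (F ⊛ G) (k ℕ.+ t) ≈ G t
  ⊛-lead {zero} zero (f , _) g = trans (*-congʳ f) (*-identityˡ _)
  ⊛-lead {suc k} {F} {G} zero (f , f≺) g rewrite ℕ.+-identityʳ k = trans (⊛-suc F G k)
    (trans (+-cong (trans (*-congʳ f) (*-identityˡ _))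
                   (⊛-zeroʳ F (λ i _ → g (suc i) (ℕ.s≤s ℕ.z≤n)) k ℕ.z≤n)) (+-identityʳ _))
  ⊛-lead {k} {F} {G} (suc t) (f , f≺) g rewrite ℕ.+-suc k t = trans (⊛-suc F G (k ℕ.+ t))
    (trans (+-cong (trans (*-congʳ (f≺ _ (ℕ.s≤s (ℕ.m≤m+n k t)))) (zeroˡ _))
                   (⊛-lead t (f , f≺) (λ i t<i → g (suc i) (ℕ.s≤s t<i)))) (+-identityˡ _))

  monic-⊛ : ∀ {k t F G} → Monic k F → Monic t G → Monic (k ℕ.+ t) (F ⊛ G)
  monic-⊛ {k} {t} {F} {G} f g = trans (⊛-lead t f (proj₂ g)) (proj₁ g) ,
    ≡.subst (F ⊛ G ≺_) (ℕ.+-suc k t) (⊛-≺ (proj₂ f) (proj₂ g))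

  ≺-mono : ∀ {F N M} → N ℕ.≤ M → F ≺ N → F ≺ M
  ≺-mono N≤M f i M≤i = f i (ℕ.≤-trans N≤M M≤i)

  -- Descent from a known bound B to N; when coefficient t is treated, the bound t + 1 is already
  -- available.
  ≺-lower : ∀ {F} N B → F ≺ B → (∀ t → N ℕ.≤ t → F ≺ suc t → F t ≈ 0#) → F ≺ N
  ≺-lower N zero f step = λ i _ → f i ℕ.z≤n
  ≺-lower {F} N (suc B) f step with N ℕ.≤? B
  ... | no N≰B = ≺-mono (ℕ.≰⇒> N≰B) f
  ... | yes N≤B = ≺-lower N B f′ step
    where
    f′ : F ≺ B
    f′ i B≤i with ℕ.m≤n⇒m<n∨m≡n B≤i
    ... | inj₁ B<i = f i B<i
    ... | inj₂ ≡.refl = step B N≤B f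

  -- B is any bound known beforehand, such as the length of a coefficient list. As F is monic, the
  -- product then determines the true bound for G.
  quotient-≺ : ∀ {k N B F G} → Monic k F → F ⊛ G ≺ k ℕ.+ N → G ≺ B → G ≺ N
  quotient-≺ {k} {N} {B} f h g = ≺-lower N B g λ t N≤t g′ →
    trans (sym (⊛-lead t f g′)) (h _ (ℕ.+-monoʳ-≤ k N≤t))

  quotient-monic : ∀ {k d B F G} → Monic k F → Monic (k ℕ.+ d) (F ⊛ G) → G ≺ B → Monic d G
  quotient-monic {k} {d} {F = F} {G} f (h , h≺) g =
    let g′ = quotient-≺ f (≡.subst (F ⊛ G ≺_) (≡.sym (ℕ.+-suc k d)) h≺) g
    in trans (sym (⊛-lead d f g′)) h , g′

  ⊛-one : ∀ {F} → Monic 0 F → ∀ G → F ⊛ G ≋ G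
  ⊛-one (f , f≺) G zero = trans (*-congʳ f) (*-identityˡ _)
  ⊛-one {F} (f , f≺) G (suc i) = trans (⊛-suc F G i)
    (trans (+-cong (trans (*-congʳ (f≺ (suc i) (ℕ.s≤s ℕ.z≤n))) (zeroˡ _)) (⊛-one (f , f≺) (tail G) i)) (+-identityˡ _))

  -- Long division, recursing on the dividend: tail H = F G + R gives H = F (X G) + (H₀ + X R).
  -- Moving `c₀` = `R k` into the quotient subtracts c₀ F from the remainder and restores its degree
  -- bound.
  divide : ∀ k {F} → Monic k F → Over F → ∀ N {H} → Over H → H ≺ N →
           ∃ λ G → ∃ λ R → Over G × Over R × R ≺ k × G ≺ N × (∀ i → H i ≈ (F ⊛ G) i + R i)
  divide zero f fq N {H} hq h = H , (λ _ → 0#) , hq , (λ _ → Fq-0#) , (λ _ _ → refl) , h ,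
    λ i → sym (trans (+-identityʳ _) (⊛-one f H i))
  divide (suc k) {F} f fq zero {H} hq h = (λ _ → 0#) , (λ _ → 0#) , (λ _ → Fq-0#) , (λ _ → Fq-0#) ,
    (λ _ _ → refl) , (λ _ _ → refl) , λ i → trans (h i ℕ.z≤n) (sym (trans (+-congʳ (⊛-zeroʳ F (λ _ _ → refl) i ℕ.z≤n)) (+-identityˡ 0#)))
  divide (suc k) {F} (f , f≺) fq (suc N) {H} hq h with divide (suc k) (f , f≺) fq N {tail H} (λ i → hq (suc i)) (λ i N≤i → h (suc i) (ℕ.s≤s N≤i))
  ... | G , R , gq , rq , r≺ , g≺ , e = G′ , R′ , gq′ , rq′ , r≺′ , g≺′ , e′
    where
    c₀ = R k
    G′ R₁ R′ : Seq
    G′ zero = c₀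
    G′ (suc i) = G i
    R₁ zero = H 0
    R₁ (suc i) = R i
    R′ i = R₁ i + - (F i * c₀)
    gq′ : Over G′
    gq′ zero = rq k
    gq′ (suc i) = gq i
    rq₁ : Over R₁
    rq₁ zero = hq 0
    rq₁ (suc i) = rq i
    rq′ : Over R′
    rq′ i = Fq-+ (rq₁ i) (Fq-neg (Fq-* (fq i) (rq k)))
    r≺′ : R′ ≺ suc k
    r≺′ (suc i) (ℕ.s≤s k≤i) with ℕ.m≤n⇒m<n∨m≡n k≤i
    ... | inj₁ k<i = trans (+-cong (r≺ i k<i) (trans (-‿cong (trans (*-congʳ (f≺ (suc i) (ℕ.s≤s k<i))) (zeroˡ _))) -0#≈0#)) (+-identityˡ 0#)
    ... | inj₂ ≡.refl = trans (+-congˡ (-‿cong (trans (*-congʳ f) (*-identityˡ _)))) (-‿inverseʳ _)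
    g≺′ : G′ ≺ suc N
    g≺′ (suc i) (ℕ.s≤s N≤i) = g≺ i N≤i
    x≈y+x-y : ∀ x y → x ≈ y + (x + - y)
    x≈y+x-y x y = trans (x-r+r x y) (+-comm _ _)
    e′ : ∀ i → H i ≈ (F ⊛ G′) i + R′ i
    e′ zero = x≈y+x-y _ _
    e′ (suc i) = begin
      H (suc i)                                         ≈⟨ e i ⟩
      (F ⊛ G) i + R i                                   ≈⟨ +-congˡ (x≈y+x-y _ (F (suc i) * c₀)) ⟩
      (F ⊛ G) i + (F (suc i) * c₀ + R′ (suc i))         ≈⟨ solve 3 (λ a b d → a :+ (b :+ d) := (b :+ a) :+ d) refl _ _ _ ⟩
      F (suc i) * c₀ + (F ⊛ G) i + R′ (suc i)           ≈⟨ +-congʳ (⊛-suc F G′ i) ⟨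
      (F ⊛ G′) (suc i) + R′ (suc i)                     ∎

  -- act N F is the operator F(σ), σ the q-Frobenius, provided F has degree below N.
  act : ℕ → Seq → Carrier → Carrier
  act N F x = ∑ {N} (λ i → F (toℕ i) * s (toℕ i) x)

  act-cong : ∀ N {F G x y} → F ≋ G → x ≈ y → act N F x ≈ act N G y
  act-cong N e e′ = ∑-cong {N} λ i → *-cong (e (toℕ i)) (s-cong (toℕ i) e′)

  act-zero : ∀ N {F} x → F ≺ 0 → act N F x ≈ 0#
  act-zero N x f = ∑-zero {N} λ i → trans (*-congʳ (f (toℕ i) ℕ.z≤n)) (zeroˡ _)

  act-0# : ∀ N F → act N F 0# ≈ 0#
  act-0# N F = ∑-zero {N} λ i → trans (*-congˡ (s-0# (toℕ i))) (zeroʳ _)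

  act-x+y : ∀ N F x y → act N F (x + y) ≈ act N F x + act N F y
  act-x+y N F x y = trans (∑-cong {N} λ i → trans (*-congˡ (s-+ (toℕ i) x y)) (distribˡ _ _ _)) (∑-+ _ _)

  act-∑ : ∀ N F {m} (f : Fin m → Carrier) → act N F (∑ f) ≈ ∑ (λ i → act N F (f i))
  act-∑ N F {zero} f = trans (act-cong N {F} (λ _ → refl) (∑-empty f)) (trans (act-0# N F) (sym (∑-empty _)))
  act-∑ N F {suc m} f = trans (act-cong N {F} (λ _ → refl) (∑-suc f)) (trans (act-x+y N F _ _)
    (trans (+-congˡ (act-∑ N F (λ i → f (suc i)))) (sym (∑-suc _))))

  act-+ : ∀ N F G x → act N (λ i → F i + G i) x ≈ act N F x + act N G x
  act-+ N F G x = trans (∑-cong {N} λ i → distribʳ _ _ _) (∑-+ _ _)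

  act-scale : ∀ N a F x → act N (λ i → a * F i) x ≈ a * act N F x
  act-scale N a F x = trans (∑-cong {N} λ i → *-assoc _ _ _) (sym (∑-*ˡ a _))

  act-s : ∀ N {F} → Over F → ∀ j x → act N F (s j x) ≈ s j (act N F x)
  act-s N {F} fq j x = trans (∑-cong {N} λ i → trans
      (*-cong (sym (Fq-s j (fq (toℕ i)))) (s-comm (toℕ i) j x)) (sym (s-* j _ _)))
    (sym (s-∑ j _))

  act-scalar : ∀ N F {a} → Fq a → ∀ x → act N F (a * x) ≈ a * act N F x
  act-scalar N F {a} fa x = trans (∑-cong {N} λ i → trans (*-congˡ (trans (s-* (toℕ i) a x) (*-congʳ (Fq-s (toℕ i) fa))))
      (solve 3 (λ f a x → f :* (a :* x) := a :* (f :* x)) refl (F (toℕ i)) a (s (toℕ i) x)))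
    (sym (∑-*ˡ a _))

  act-comm : ∀ N M {F G} → Over F → Over G → ∀ x → act N F (act M G x) ≈ act M G (act N F x)
  act-comm N M {F} {G} fq gq x = trans (act-∑ N F _) (∑-cong {M} λ i →
    trans (act-scalar N F (gq (toℕ i)) _) (*-congˡ (act-s N fq (toℕ i) x)))

  -- A Horner step: σ can be pulled out of the higher terms because it fixes their coefficients.
  act-suc : ∀ N F → Over F → ∀ x → act (suc N) F x ≈ F 0 * x + s 1 (act N (tail F) x)
  act-suc N F fq x = trans (∑-suc _) (+-cong (*-congˡ (s-zero x)) (trans (∑-cong {N} λ i →
      trans (*-cong (sym (fq (suc (toℕ i)))) (sym (s-s 1 (toℕ i) x))) (sym (s-* 1 _ _)))
    (sym (s-∑ 1 _))))

  act-last : ∀ N F x → act (suc N) F x ≈ act N F x + F N * s N x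
  act-last N F x = begin
    act (suc N) F x                                       ≈⟨ ∑≈sum {suc N} (λ i → F (toℕ i) * s (toℕ i) x) ⟩
    sum {suc N} (λ i → F (toℕ i) * s (toℕ i) x)                   ≈⟨ sum-init-last {N} (λ i → F (toℕ i) * s (toℕ i) x) ⟩
    sum {N} (λ i → F (toℕ (inject₁ i)) * s (toℕ (inject₁ i)) x) + F (toℕ (fromℕ N)) * s (toℕ (fromℕ N)) x
      ≈⟨ +-cong (trans (sum-cong-≋ {N} λ i → reflexive (≡.cong (λ m → F m * s m x) (Fin.toℕ-inject₁ i))) (sym (∑≈sum _)))
                (reflexive (≡.cong (λ m → F m * s m x) (Fin.toℕ-fromℕ N))) ⟩
    act N F x + F N * s N x                               ∎
    where open Algebra.Properties.CommutativeMonoid.Sum +-commutativeMonoid using (sum; sum-init-last; sum-cong-≋)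

  act-≺ : ∀ {N M F} → F ≺ N → N ℕ.≤ M → ∀ x → act M F x ≈ act N F x
  act-≺ {N} {M} {F} f N≤M x with ℕ.m≤n⇒∃[o]m+o≡n N≤M
  ... | o , ≡.refl = go o
    where
    go : ∀ o → act (N ℕ.+ o) F x ≈ act N F x
    go zero rewrite ℕ.+-identityʳ N = refl
    go (suc o) rewrite ℕ.+-suc N o = trans (act-last (N ℕ.+ o) F x)
      (trans (+-cong (go o) (trans (*-congʳ (f _ (ℕ.m≤m+n N o))) (zeroˡ _))) (+-identityʳ _))

  -- Induction on the bound for G, matching `⊛-suc` with the Horner step for G.
  act-⊛ : ∀ N M {F G} → F ≺ N → G ≺ M → Over F → Over G → ∀ x → act (N ℕ.+ M) (F ⊛ G) x ≈ act M G (act N F x)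
  act-⊛ N zero {F} {G} f g fq gq x = trans (act-zero (N ℕ.+ 0) x (⊛-zeroʳ F g)) (sym (act-zero 0 {G} _ g))
  act-⊛ N (suc M) {F} {G} f g fq gq x rewrite ℕ.+-suc N M = begin
    act (suc L) (F ⊛ G) x
      ≈⟨ act-suc L (F ⊛ G) (⊛-over fq gq) x ⟩
    F 0 * G 0 * x + s 1 (act L (tail (F ⊛ G)) x)
      ≈⟨ +-congˡ (s-cong 1 (trans (act-cong L (λ i → trans (⊛-suc F G i) (+-congʳ (*-comm _ _))) refl)
           (trans (act-+ L (λ i → G 0 * F (suc i)) (F ⊛ tail G) x)
             (+-cong (act-scale L (G 0) (tail F) x) (act-⊛ N M f (λ i M≤i → g (suc i) (ℕ.s≤s M≤i)) fq (λ i → gq (suc i)) x))))) ⟩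
    F 0 * G 0 * x + s 1 (G 0 * act L (tail F) x + act M (tail G) (act N F x))
      ≈⟨ +-congˡ (trans (s-+ 1 _ _) (+-congʳ (trans (s-* 1 _ _) (*-congʳ (gq 0))))) ⟩
    F 0 * G 0 * x + (G 0 * s 1 (act L (tail F) x) + s 1 (act M (tail G) (act N F x)))
      ≈⟨ solve 5 (λ f g x a b → f :* g :* x :+ (g :* a :+ b) := g :* (f :* x :+ a) :+ b) refl (F 0) (G 0) x _ _ ⟩
    G 0 * (F 0 * x + s 1 (act L (tail F) x)) + s 1 (act M (tail G) (act N F x))
      ≈⟨ +-congʳ (*-congˡ (trans (sym (act-suc L F fq x)) (act-≺ f (ℕ.m≤n⇒m≤1+n (ℕ.m≤m+n N M)) x))) ⟩
    G 0 * act N F x + s 1 (act M (tail G) (act N F x))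
      ≈⟨ act-suc M G gq (act N F x) ⟨
    act (suc M) G (act N F x) ∎
    where L = N ℕ.+ M

  -- As σ^t x = x^(q^t), the operator is a polynomial function of degree at most q^t; 1 < q keeps
  -- the degrees of the lower terms strictly smaller.
  poly-act : ∀ t F → IsPolynomial (q ℕ.^ t) (F t) (act (suc t) F)
  poly-act t F = poly-resp (q ℕ.^ t) (λ x → sym (act-last t F x))
    (poly-respˡ (q ℕ.^ t) (trans (+-identityˡ _) (*-identityʳ _))
      (poly-+ (q ℕ.^ t) (lower t) (poly-* (q ℕ.^ t) (F t) (poly-s t))))
    where
    lower : ∀ t → IsPolynomial (q ℕ.^ t) 0# (act t F)
    lower zero = poly-resp (q ℕ.^ 0) (λ x → sym (∑-empty _)) (poly-0 (q ℕ.^ 0))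
    lower (suc t) = poly-weaken< (ℕ.^-monoʳ-< q 1<q (ℕ.n<1+n t)) (poly-act t F)

  act-vanishes⇒lead≈0 : ∀ t F → t ℕ.< n → (∀ x → act (suc t) F x ≈ 0#) → F t ≈ 0#
  act-vanishes⇒lead≈0 t F t<n = vanishing-polynomial (poly-act t F) (ℕ.^-monoʳ-< q 1<q t<n)

  -- Vectors and the polynomials that kill them

  monic-resp : ∀ {k F G} → F ≋ G → Monic k F → Monic k G
  monic-resp {k} e (f , f≺) = trans (sym (e k)) f , λ i k<i → trans (sym (e i)) (f≺ i k<i)

  ≺-resp : ∀ {N F G} → F ≋ G → F ≺ N → G ≺ N
  ≺-resp e f i N≤i = trans (sym (e i)) (f i N≤i)

  monic≉0 : ∀ {k F} → Monic k F → ¬ (F ≺ 0)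
  monic≉0 {k} (f , _) z = 0≉1 (trans (sym (z k ℕ.z≤n)) f)

  infixr 8 _⟨_⟩_
  _⟨_⟩_ : Seq → ℕ → Carrier → Carrier
  F ⟨ k ⟩ x = act (suc k) F x

  ⟨⟩-cong : ∀ k F {x y} → x ≈ y → F ⟨ k ⟩ x ≈ F ⟨ k ⟩ y
  ⟨⟩-cong k F = act-cong (suc k) {F} (λ _ → refl)

  ⟨⟩-0# : ∀ k F {x} → x ≈ 0# → F ⟨ k ⟩ x ≈ 0#
  ⟨⟩-0# k F e = trans (⟨⟩-cong k F e) (act-0# (suc k) F)

  ⟨⟩-⊛ : ∀ {k t F G} → Monic k F → Monic t G → Over F → Over G → ∀ x → (F ⊛ G) ⟨ k ℕ.+ t ⟩ x ≈ G ⟨ t ⟩ F ⟨ k ⟩ x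
  ⟨⟩-⊛ {k} {t} f g fq gq x = trans
    (sym (act-≺ (proj₂ (monic-⊛ f g)) (ℕ.s≤s (ℕ.+-monoʳ-≤ k (ℕ.n≤1+n t))) x))
    (act-⊛ (suc k) (suc t) (proj₂ f) (proj₂ g) fq gq x)

  monic-nonvanishing : ∀ t {F} → Monic t F → t ℕ.< n → ∃ λ x → F ⟨ t ⟩ x ≉0
  monic-nonvanishing t {F} (f , _) t<n with allZero? (λ i → F ⟨ t ⟩ enum i)
  ... | inj₂ (i , p) = enum i , p
  ... | inj₁ z = contradiction (trans (sym (act-vanishes⇒lead≈0 t F t<n λ x →
          trans (⟨⟩-cong t F (sym (enum-index x))) (z (index x)))) f) 0≉1

  -- Together with a monic polynomial of degree k over F_q that kills x, this says that this
  -- polynomial is the minimal polynomial, or order, of x.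
  Independent : ℕ → Carrier → Set _
  Independent k x = ∀ F → Over F → F ≺ k → act k F x ≈ 0# → F ≺ 0

  -- The remainder of H modulo F kills x and has degree below k, so it is zero.
  annihilator-divides : ∀ k {F} → Monic k F → Over F → ∀ {x} → Independent k x → F ⟨ k ⟩ x ≈ 0# →
                        ∀ N {H} → Over H → H ≺ N → act N H x ≈ 0# → ∃ λ G → Over G × G ≺ N × H ≋ F ⊛ G
  annihilator-divides k {F} f fq {x} ind Fx N {H} hq h Hx with divide k f fq N hq h
  ... | G , R , gq , rq , r≺ , g≺ , e = G , gq , g≺ , λ i →
        trans (e i) (trans (+-congˡ (ind R rq r≺ Rx i ℕ.z≤n)) (+-identityʳ _))
    where
    L = suc k ℕ.+ N
    Rx : act k R x ≈ 0#
    Rx = begin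
      act k R x                        ≈⟨ act-≺ r≺ (ℕ.m≤n⇒m≤1+n (ℕ.m≤m+n k N)) x ⟨
      act L R x                        ≈⟨ +-identityˡ _ ⟨
      0# + act L R x                   ≈⟨ +-congʳ (trans (act-⊛ (suc k) N (proj₂ f) g≺ fq gq x)
                                            (trans (act-cong N {G} (λ _ → refl) Fx) (act-0# N G))) ⟨
      act L (F ⊛ G) x + act L R x      ≈⟨ act-+ L (F ⊛ G) R x ⟨
      act L (λ i → (F ⊛ G) i + R i) x  ≈⟨ act-cong L e refl ⟨
      act L H x                        ≈⟨ act-≺ h (ℕ.m≤n+m N (suc k)) x ⟩
      act N H x                        ≈⟨ Hx ⟩
      0#                               ∎

  normalise : ∀ {t F} → Over F → F ≺ suc t → F t ≉0 → ∃ λ u → Monic t (λ i → u * F i) × Over (λ i → u * F i)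
  normalise {t} {F} fq f p =
    let u , e = inverse (F t) p
        uq = Fq-inverse e (fq t)
    in u , (trans (*-comm _ _) e , λ i t<i → trans (*-congˡ (f i t<i)) (zeroʳ u)) , λ i → Fq-* uq (fq i)

  -- σ satisfies no equation of degree below n, so every monic divisor of X^n - 1 of positive
  -- degree kills some w ≠ 0. A pair (w , P) with P(w) = 0, h(w) = 0, w ≠ 0 and deg P least plays
  -- the role of an irreducible factor P of h: by minimality every nonzero vector killed by h is
  -- independent up to degree m = deg P.
  module Step (d e : ℕ) {h Q : Seq} (d+e≡n : d ℕ.+ e ≡ n)
              (h-monic : Monic d h) (h-over : Over h) (Q-monic : Monic e Q) (Q-over : Over Q)
              (hQ≈0 : ∀ x → h ⟨ d ⟩ Q ⟨ e ⟩ x ≈ 0#) where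

    Killed : ℕ → Set _
    Killed m = ∃ λ w → w ≉0 × h ⟨ d ⟩ w ≈ 0# × ∃ λ P → Monic m P × Over P × P ⟨ m ⟩ w ≈ 0#

    -- h kills the image of Q, which is nonzero because deg Q < n. With P = h this starts the search
    -- for a least degree.
    killed-d : 0 ℕ.< d → Killed d
    killed-d 0<d =
      let z , Qz≉0 = monic-nonvanishing e Q-monic (≡.subst (e ℕ.<_) d+e≡n (ℕ.m<n+m e 0<d))
      in Q ⟨ e ⟩ z , Qz≉0 , hQ≈0 z , h , h-monic , h-over , hQ≈0 z

    module Least {m} (minimal : ∀ i → i ℕ.< m → ¬ Killed i) where

      independent-m : ∀ {w} → w ≉0 → h ⟨ d ⟩ w ≈ 0# → Independent m w
      independent-m {w} w≉0 hw F fq f Fw = ≺-lower 0 m f λ t _ f′ →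
        decidable-stable (F t ≟ 0#) λ p → killed t f′ p
        where
        killed : ∀ t → F ≺ suc t → F t ≉0 → ⊥
        killed t f′ p with t ℕ.<? m
        ... | no t≮m = p (f t (ℕ.≮⇒≥ t≮m))
        ... | yes t<m =
          let u , monic , over = normalise fq f′ p
          in minimal t t<m (w , w≉0 , hw , _ , monic , over ,
               trans (act-scale (suc t) u F w) (trans (*-congˡ (trans (sym (act-≺ f′ t<m w)) Fw)) (zeroʳ u)))

      0<m : ∀ {w P} → w ≉0 → Monic m P → P ⟨ m ⟩ w ≈ 0# → 0 ℕ.< m
      0<m {w} {P} w≉0 (p , _) Pw = ℕ.n≢0⇒n>0 λ { ≡.refl → w≉0 (begin
        w                       ≈⟨ trans (*-congʳ p) (trans (*-identityˡ _) (s-zero w)) ⟨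
        P 0 * s 0 w             ≈⟨ +-identityˡ _ ⟨
        0# + P 0 * s 0 w        ≈⟨ +-congʳ (∑-empty _) ⟨
        act 0 P w + P 0 * s 0 w ≈⟨ act-last 0 P w ⟨
        P ⟨ 0 ⟩ w               ≈⟨ Pw ⟩
        0#                      ∎) }

      module Factor {d′ P h′} (0<m : 0 ℕ.< m) (m+d′≡d : m ℕ.+ d′ ≡ d) (P-monic : Monic m P) (P-over : Over P)
                    (h′-monic : Monic d′ h′) (h′-over : Over h′) (h≋ : h ≋ P ⊛ h′) where

        h≈ : ∀ x → h ⟨ d ⟩ x ≈ h′ ⟨ d′ ⟩ P ⟨ m ⟩ x
        h≈ x = trans (act-cong (suc d) h≋ refl) (trans (reflexive (≡.cong (λ d → (P ⊛ h′) ⟨ d ⟩ x) (≡.sym m+d′≡d)))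
                 (⟨⟩-⊛ P-monic h′-monic P-over h′-over x))

        -- P is moved from h to Q. The pair (h′ , Q′) satisfies the same hypotheses with a smaller
        -- degree of h′, and the induction yields a vector of order h′ in the form P(σ)x with x in
        -- the image of Q.
        Q′ : Seq
        Q′ = P ⊛ Q

        Q′-monic : Monic (m ℕ.+ e) Q′
        Q′-monic = monic-⊛ P-monic Q-monic

        Q′≈ : ∀ x → Q′ ⟨ m ℕ.+ e ⟩ x ≈ P ⟨ m ⟩ Q ⟨ e ⟩ x
        Q′≈ x = trans (⟨⟩-⊛ P-monic Q-monic P-over Q-over x) (act-comm (suc e) (suc m) Q-over P-over x)

        h′Q′≈0 : ∀ x → h′ ⟨ d′ ⟩ Q′ ⟨ m ℕ.+ e ⟩ x ≈ 0#
        h′Q′≈0 x = trans (⟨⟩-cong d′ h′ (Q′≈ x)) (trans (sym (h≈ _)) (hQ≈0 x))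

        d′+m+e≡n : d′ ℕ.+ (m ℕ.+ e) ≡ n
        d′+m+e≡n = ≡.trans (≡.sym (ℕ.+-assoc d′ m e)) (≡.trans (≡.cong (ℕ._+ e) (≡.trans (ℕ.+-comm d′ m) m+d′≡d)) d+e≡n)

        d′<d : d′ ℕ.< d
        d′<d = ≡.subst (d′ ℕ.<_) m+d′≡d (ℕ.m<n+m d′ 0<m)

        -- `x′` = P(σ)x has order h′. It remains to alter x inside the image of Q, without changing
        -- P(σ)x, so that h′ does not kill it; its order is then P h′ = h.
        module Extend (y′ : Carrier) (ind′ : Independent d′ (Q′ ⟨ m ℕ.+ e ⟩ y′)) where
          x x′ : Carrier
          x = Q ⟨ e ⟩ y′
          x′ = Q′ ⟨ m ℕ.+ e ⟩ y′

          -- The correction `v` must lie in the image of Q and be killed by P. Values of h′ Q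
          -- qualify, because h Q = P h′ Q kills K, and some value is nonzero because deg (h′ Q) <
          -- n.
          nonvanishing : ∃ λ z → (h′ ⊛ Q) ⟨ d′ ℕ.+ e ⟩ z ≉0
          nonvanishing = monic-nonvanishing (d′ ℕ.+ e) (monic-⊛ h′-monic Q-monic)
            (≡.subst (d′ ℕ.+ e ℕ.<_) d+e≡n (ℕ.+-monoˡ-< e d′<d))

          z v : Carrier
          z = proj₁ nonvanishing
          v = Q ⟨ e ⟩ h′ ⟨ d′ ⟩ z

          v≉0 : v ≉0
          v≉0 p = proj₂ nonvanishing (trans (⟨⟩-⊛ h′-monic Q-monic h′-over Q-over z) p)

          Pv : P ⟨ m ⟩ v ≈ 0#
          Pv = begin
            P ⟨ m ⟩ Q ⟨ e ⟩ h′ ⟨ d′ ⟩ z   ≈⟨ act-comm (suc m) (suc e) P-over Q-over _ ⟩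
            Q ⟨ e ⟩ P ⟨ m ⟩ h′ ⟨ d′ ⟩ z   ≈⟨ ⟨⟩-cong e Q (act-comm (suc m) (suc d′) P-over h′-over z) ⟩
            Q ⟨ e ⟩ h′ ⟨ d′ ⟩ P ⟨ m ⟩ z   ≈⟨ ⟨⟩-cong e Q (h≈ z) ⟨
            Q ⟨ e ⟩ h ⟨ d ⟩ z             ≈⟨ act-comm (suc e) (suc d) Q-over h-over z ⟩
            h ⟨ d ⟩ Q ⟨ e ⟩ z             ≈⟨ hQ≈0 z ⟩
            0#                            ∎

          killedByP : ∀ {w} → P ⟨ m ⟩ w ≈ 0# → h ⟨ d ⟩ w ≈ 0#
          killedByP {w} e = trans (h≈ w) (⟨⟩-0# d′ h′ e)

          -- If h′ killed both x and v, then P would divide h′ (as v has order P), and h′/P would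
          -- kill x′ = P(x), which has order h′.
          x-killed⇒v-not : h′ ⟨ d′ ⟩ x ≈ 0# → h′ ⟨ d′ ⟩ v ≉0
          x-killed⇒v-not h′x h′v =
            let h″ , h″-over , h″≺ , h′≋ = annihilator-divides m P-monic P-over (independent-m v≉0 (killedByP Pv)) Pv
                                             (suc d′) h′-over (proj₂ h′-monic) h′v
                h″≺d′ = quotient-≺ P-monic (≺-resp h′≋ (≺-mono (ℕ.+-monoˡ-≤ d′ 0<m) (proj₂ h′-monic))) h″≺
                h″x′ = begin
                  act d′ h″ x′                        ≈⟨ act-≺ h″≺d′ (ℕ.n≤1+n d′) x′ ⟨
                  act (suc d′) h″ x′                  ≈⟨ ⟨⟩-cong d′ h″ (Q′≈ y′) ⟩
                  act (suc d′) h″ (P ⟨ m ⟩ x)         ≈⟨ act-⊛ (suc m) (suc d′) (proj₂ P-monic) h″≺ P-over h″-over x ⟨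
                  act (suc m ℕ.+ suc d′) (P ⊛ h″) x   ≈⟨ act-cong (suc m ℕ.+ suc d′) h′≋ refl ⟨
                  act (suc m ℕ.+ suc d′) h′ x         ≈⟨ act-≺ (proj₂ h′-monic) (ℕ.m≤n+m (suc d′) (suc m)) x ⟩
                  act (suc d′) h′ x                   ≈⟨ h′x ⟩
                  0#                                  ∎
            in monic≉0 h′-monic (≺-resp (λ i → sym (h′≋ i)) (⊛-zeroʳ P (ind′ h″ h″-over h″≺d′ h″x′)))

          preimage : ∃ λ y → P ⟨ m ⟩ Q ⟨ e ⟩ y ≈ x′ × h′ ⟨ d′ ⟩ Q ⟨ e ⟩ y ≉0
          preimage with (h′ ⟨ d′ ⟩ x) ≟ 0#
          ... | no p = y′ , sym (Q′≈ y′) , p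
          -- Q(σ) takes this to x + v. P does not see the change, whereas h′ maps x + v to its value
          -- at v, which is nonzero.
          ... | yes h′x = y′ + h′ ⟨ d′ ⟩ z ,
                  (begin
                    P ⟨ m ⟩ Q ⟨ e ⟩ (y′ + h′ ⟨ d′ ⟩ z) ≈⟨ ⟨⟩-cong m P (act-x+y (suc e) Q _ _) ⟩
                    P ⟨ m ⟩ (x + v)                    ≈⟨ act-x+y (suc m) P x v ⟩
                    P ⟨ m ⟩ x + P ⟨ m ⟩ v              ≈⟨ +-cong (sym (Q′≈ y′)) Pv ⟩
                    x′ + 0#                            ≈⟨ +-identityʳ x′ ⟩
                    x′                                 ∎) ,
                  λ p → x-killed⇒v-not h′x (begin
                    h′ ⟨ d′ ⟩ v                 ≈⟨ +-identityˡ _ ⟨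
                    0# + h′ ⟨ d′ ⟩ v            ≈⟨ +-congʳ h′x ⟨
                    h′ ⟨ d′ ⟩ x + h′ ⟨ d′ ⟩ v   ≈⟨ act-x+y (suc d′) h′ x v ⟨
                    h′ ⟨ d′ ⟩ (x + v)           ≈⟨ ⟨⟩-cong d′ h′ (act-x+y (suc e) Q _ _) ⟨
                    h′ ⟨ d′ ⟩ Q ⟨ e ⟩ (y′ + h′ ⟨ d′ ⟩ z) ≈⟨ p ⟩
                    0#                          ∎)

          -- A polynomial F of degree below d that kills x₂ also kills x′, so F = h′ C with deg C <
          -- m. Then C kills h′(σ)x₂, a nonzero vector killed by P, and minimality of m gives C = 0.
          independent-preimage : ∀ {x₂} → P ⟨ m ⟩ x₂ ≈ x′ → h′ ⟨ d′ ⟩ x₂ ≉0 → Independent d x₂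
          independent-preimage {x₂} Px₂ h′x₂≉0 F F-over F≺ Fx₂ =
            let Fx′ = begin
                  act d F x′              ≈⟨ act-cong d {F} (λ _ → refl) Px₂ ⟨
                  act d F (P ⟨ m ⟩ x₂)    ≈⟨ act-comm d (suc m) F-over P-over x₂ ⟩
                  P ⟨ m ⟩ act d F x₂      ≈⟨ ⟨⟩-0# m P Fx₂ ⟩
                  0#                      ∎
                C , C-over , C≺ , F≋ = annihilator-divides d′ h′-monic h′-over ind′ (h′Q′≈0 y′) d F-over F≺ Fx′
                C≺m = quotient-≺ h′-monic (≺-resp F≋ (≡.subst (F ≺_) (≡.trans (≡.sym m+d′≡d) (ℕ.+-comm m d′)) F≺)) C≺
                m≤d = ≡.subst (m ℕ.≤_) m+d′≡d (ℕ.m≤m+n m d′)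
                w = h′ ⟨ d′ ⟩ x₂
                Cw = begin
                  act m C w                           ≈⟨ act-≺ C≺m m≤d w ⟨
                  act d C w                           ≈⟨ act-⊛ (suc d′) d (proj₂ h′-monic) C≺ h′-over C-over x₂ ⟨
                  act (suc d′ ℕ.+ d) (h′ ⊛ C) x₂      ≈⟨ act-cong (suc d′ ℕ.+ d) F≋ refl ⟨
                  act (suc d′ ℕ.+ d) F x₂             ≈⟨ act-≺ F≺ (ℕ.m≤n+m d (suc d′)) x₂ ⟩
                  act d F x₂                          ≈⟨ Fx₂ ⟩
                  0#                                  ∎
                Pw = begin
                  P ⟨ m ⟩ w                    ≈⟨ act-comm (suc m) (suc d′) P-over h′-over x₂ ⟩
                  h′ ⟨ d′ ⟩ P ⟨ m ⟩ x₂         ≈⟨ ⟨⟩-cong d′ h′ Px₂ ⟩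
                  h′ ⟨ d′ ⟩ x′                 ≈⟨ h′Q′≈0 y′ ⟩
                  0#                           ∎
            in ≺-resp (λ i → sym (F≋ i)) (⊛-zeroʳ h′ (independent-m h′x₂≉0 (killedByP Pw) C C-over C≺m Cw))

  -- The vector is sought in the image of the cofactor Q because h then kills it automatically. The
  -- double negation comes from `least`.
  VectorOfOrder : ℕ → Set _
  VectorOfOrder d = ∀ e {h Q} → d ℕ.+ e ≡ n → Monic d h → Over h → Monic e Q → Over Q →
                    (∀ x → h ⟨ d ⟩ Q ⟨ e ⟩ x ≈ 0#) → ¬ ¬ (∃ λ y → Independent d (Q ⟨ e ⟩ y))

  vectorOfOrder : ∀ d → VectorOfOrder d
  vectorOfOrder = <-rec VectorOfOrder step
    where
    step : ∀ d → (∀ {d′} → d′ ℕ.< d → VectorOfOrder d′) → VectorOfOrder d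
    step zero ih e _ _ _ _ _ _ none = none (0# , λ F _ f _ → f)
    step (suc d₀) ih e {h} {Q} d+e≡n h-monic h-over Q-monic Q-over hQ≈0 none =
      least Killed d (killed-d ℕ.z<s) λ where
        (m , (w , w≉0 , hw , P , P-monic , P-over , Pw) , minimal) →
          let open Least minimal
              -- The least degree is at most d, because h itself is a candidate.
              d′ , m+d′≡d = ℕ.m≤n⇒∃[o]m+o≡n (ℕ.≮⇒≥ λ d<m → minimal d d<m (killed-d ℕ.z<s))
              h′ , h′-over , h′≺ , h≋ = annihilator-divides m P-monic P-over (independent-m w≉0 hw) Pw
                                          (suc d) h-over (proj₂ h-monic) hw
              h′-monic = quotient-monic P-monic (monic-resp h≋ (≡.subst (λ d → Monic d h) (≡.sym m+d′≡d) h-monic)) h′≺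
              open Factor (0<m w≉0 P-monic Pw) m+d′≡d P-monic P-over h′-monic h′-over h≋
          in ih d′<d (m ℕ.+ e) d′+m+e≡n h′-monic h′-over Q′-monic (⊛-over P-over Q-over) h′Q′≈0 λ where
               (y′ , ind′) →
                 let open Extend y′ ind′
                     y , Px₂ , h′x₂ = preimage
                 in none (y , independent-preimage Px₂ h′x₂)
      where
      d = suc d₀
      open Step d e d+e≡n h-monic h-over Q-monic Q-over hQ≈0

  -- From determinants and coefficient lists to the two conditions of the theorem

  s-1≡pow : ∀ x → s 1 x ≡ pow K x q
  s-1≡pow x = ≡.trans (s≡pow 1 x) (≡.cong (pow K x) (ℕ.*-identityʳ q))

  InFq⇒Fq : ∀ {x} → InFq K q x → Fq x
  InFq⇒Fq {x} f = trans (reflexive (s-1≡pow x)) f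

  Fq⇒InFq : ∀ {x} → Fq x → InFq K q x
  Fq⇒InFq {x} f = trans (reflexive (≡.sym (s-1≡pow x))) f

  pad : ∀ {m} → (Fin m → Carrier) → Seq
  pad {zero} f _ = 0#
  pad {suc m} f zero = f zero
  pad {suc m} f (suc i) = pad (λ j → f (suc j)) i

  pad-toℕ : ∀ {m} (f : Fin m → Carrier) i → pad f (toℕ i) ≡ f i
  pad-toℕ {suc m} f zero = ≡.refl
  pad-toℕ {suc m} f (suc i) = pad-toℕ (λ j → f (suc j)) i

  pad-≺ : ∀ {m} (f : Fin m → Carrier) → pad f ≺ m
  pad-≺ {zero} f i _ = refl
  pad-≺ {suc m} f (suc i) (ℕ.s≤s m≤i) = pad-≺ (λ j → f (suc j)) i m≤i

  pad-over : ∀ {m} (f : Fin m → Carrier) → (∀ i → Fq (f i)) → Over (pad f)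
  pad-over {zero} f fq i = Fq-0#
  pad-over {suc m} f fq zero = fq zero
  pad-over {suc m} f fq (suc i) = pad-over (λ j → f (suc j)) (λ j → fq (suc j)) i

  independent⇒¬dependent : ∀ {k x} → Independent k x → ¬ Dependent {k} (λ i → s (toℕ i) x)
  independent⇒¬dependent {k} {x} ind (f , fq , (i , p) , e) = p (trans (reflexive (≡.sym (pad-toℕ f i)))
    (ind (pad f) (pad-over f fq) (pad-≺ f)
      (trans (∑-cong {k} λ i → *-congʳ (reflexive (pad-toℕ f i))) e) (toℕ i) ℕ.z≤n))

  ¬dependent⇒independent : ∀ {k x} → ¬ Dependent {k} (λ i → s (toℕ i) x) → Independent k x
  ¬dependent⇒independent {k} indep F fq f Fx = ≺-lower 0 k f λ t _ _ →
    decidable-stable (F t ≟ 0#) λ p → killed t p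
    where
    killed : ∀ t → F t ≉0 → ⊥
    killed t p with t ℕ.<? k
    ... | no t≮k = p (f t (ℕ.≮⇒≥ t≮k))
    ... | yes t<k = indep ((λ i → F (toℕ i)) , (λ i → fq (toℕ i)) ,
                     (fromℕ< t<k , ≡.subst (λ t → F t ≉0) (≡.sym (Fin.toℕ-fromℕ< t<k)) p) , Fx)

  conjugate-power : ∀ i j x → pow K (pow K x (q ℕ.^ j)) (q ℕ.^ i) ≈ s j (s i x)
  conjugate-power i j x = trans (reflexive (≡.sym (≡.trans (s≡pow i _) (≡.cong (λ y → pow K y (q ℕ.^ i)) (s≡pow j x)))))
    (s-comm i j x)

  moore≈ : ∀ k x → moore K q k (conjugates K q k x) ≈ det K k (mooreMatrix (λ i → s (toℕ i) x))
  moore≈ k x = det-cong k λ i j → conjugate-power (toℕ i) (toℕ j) x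

  moore₁≈ : ∀ k x → moore₁ K q k (conjugates K q k x) ≈ det K k (mooreMatrix (λ i → s (rowExp₁ K i) x))
  moore₁≈ k x = det-cong k λ i j → conjugate-power (rowExp₁ K i) (toℕ j) x

  moore≉0⇒independent : ∀ {k x} → moore K q k (conjugates K q k x) ≉0 → Independent k x
  moore≉0⇒independent {k} {x} p = ¬dependent⇒independent λ dep →
    p (trans (moore≈ k x) (dependent⇒det≈0 k _ dep))

  independent⇒moore≉0 : ∀ {k x} → Independent k x → moore K q k (conjugates K q k x) ≉0
  independent⇒moore≉0 {k} {x} ind e = independent⇒¬dependent ind
    (det≈0⇒dependent k _ (trans (sym (moore≈ k x)) e))

  -- The exponents 0, ..., k other than 1 are exactly those of the rows of Δ₁, so a polynomial
  -- without a term in X is a relation among these rows.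
  act-rowExp₁ : ∀ {k} → 2 ≤ k → ∀ F x → F 1 ≈ 0# → F ⟨ k ⟩ x ≈ ∑ {k} (λ i → F (rowExp₁ K i) * s (rowExp₁ K i) x)
  act-rowExp₁ {suc k} (ℕ.s≤s _) F x F₁ = begin
    ∑ (λ i → F (toℕ i) * s (toℕ i) x)                              ≈⟨ trans (∑-suc _) (+-congˡ (∑-suc _)) ⟩
    F 0 * s 0 x + (F 1 * s 1 x + rest)                             ≈⟨ +-congˡ (trans (+-congʳ (trans (*-congʳ F₁) (zeroˡ _))) (+-identityˡ _)) ⟩
    F 0 * s 0 x + rest                                             ≈⟨ ∑-suc {k} (λ i → F (rowExp₁ K i) * s (rowExp₁ K i) x) ⟨
    ∑ {suc k} (λ i → F (rowExp₁ K i) * s (rowExp₁ K i) x)          ∎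
    where rest = ∑ {k} (λ i → F (suc (suc (toℕ i))) * s (suc (suc (toℕ i))) x)

  -- Ensures that the leading coefficient occurs in the relation, which is therefore nontrivial. For
  -- k = 1 the only exponent would be 0.
  rowExp₁-last : ∀ {k} → 2 ≤ k → ∃ λ i → rowExp₁ K {k} i ≡ k
  rowExp₁-last {suc (suc k)} (ℕ.s≤s (ℕ.s≤s _)) = suc (fromℕ k) , ≡.cong (λ i → suc (suc i)) (Fin.toℕ-fromℕ k)

  spread : ∀ {k} → 2 ≤ k → (f : Fin k → Carrier) → (∀ i → Fq (f i)) →
           ∃ λ F → Over F × F ≺ suc k × F 1 ≈ 0# × (∀ i → F (rowExp₁ K i) ≡ f i)
  spread {suc k} (ℕ.s≤s 1≤k) f f-over = F , over , F≺ , refl , at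
    where
    F : Seq
    F zero = f zero
    F (suc zero) = 0#
    F (suc (suc i)) = pad (λ j → f (suc j)) i
    over : Over F
    over zero = f-over zero
    over (suc zero) = Fq-0#
    over (suc (suc i)) = pad-over (λ j → f (suc j)) (λ j → f-over (suc j)) i
    F≺ : F ≺ suc (suc k)
    F≺ (suc (suc i)) (ℕ.s≤s (ℕ.s≤s p)) = pad-≺ (λ j → f (suc j)) i p
    F≺ (suc zero) (ℕ.s≤s ())
    at : ∀ i → F (rowExp₁ K i) ≡ f i
    at zero = ≡.refl
    at (suc i) = pad-toℕ (λ j → f (suc j)) i

  xn-1-over : Over (xn-1 K n)
  xn-1-over i with i ℕ.≟ 0 | i ℕ.≟ n
  ... | yes _ | yes _ = Fq-1#
  ... | yes _ | no _ = Fq-neg Fq-1#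
  ... | no _ | yes _ = Fq-1#
  ... | no _ | no _ = Fq-0#

  xn-1-at-0 : xn-1 K n 0 ≈ - 1#
  xn-1-at-0 with 0 ℕ.≟ n
  ... | yes ≡.refl = contradiction 1≤n λ ()
  ... | no _ = refl

  xn-1-at-n : xn-1 K n n ≈ 1#
  xn-1-at-n with n ℕ.≟ 0 | n ℕ.≟ n
  ... | yes _ | yes _ = refl
  ... | no _ | yes _ = refl
  ... | _ | no p = contradiction ≡.refl p

  xn-1-off : ∀ i → i ≢ 0 → i ≢ n → xn-1 K n i ≈ 0#
  xn-1-off i i≢0 i≢n with i ℕ.≟ 0 | i ℕ.≟ n
  ... | yes p | _ = contradiction p i≢0
  ... | no _ | yes p = contradiction p i≢n
  ... | no _ | no _ = refl

  xn-1-monic : Monic n (xn-1 K n)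
  xn-1-monic = xn-1-at-n , λ i n<i → xn-1-off i (λ { ≡.refl → contradiction n<i λ () }) (λ { ≡.refl → ℕ.<-irrefl ≡.refl n<i })

  xn-1-kills : ∀ x → xn-1 K n ⟨ n ⟩ x ≈ 0#
  xn-1-kills x = begin
    xn-1 K n ⟨ n ⟩ x                               ≈⟨ act-last n (xn-1 K n) x ⟩
    act n (xn-1 K n) x + xn-1 K n n * s n x        ≈⟨ +-cong constant (trans (*-cong xn-1-at-n (s-n x)) (*-identityˡ x)) ⟩
    - x + x                                        ≈⟨ -‿inverseˡ x ⟩
    0#                                             ∎
    where
    constant : act n (xn-1 K n) x ≈ - x
    constant = begin
      act n (xn-1 K n) x
        ≈⟨ ∑-single {n} (fromℕ< 1≤n) _ (λ i i≢ → trans (*-congʳ (xn-1-off (toℕ i)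
             (λ e → i≢ (Fin.toℕ-injective (≡.trans e (≡.sym (Fin.toℕ-fromℕ< 1≤n))))) (ℕ.<⇒≢ (Fin.toℕ<n i)))) (zeroˡ _)) ⟩
      xn-1 K n (toℕ (fromℕ< 1≤n)) * s (toℕ (fromℕ< 1≤n)) x
        ≈⟨ reflexive (≡.cong (λ i → xn-1 K n i * s i x) (Fin.toℕ-fromℕ< 1≤n)) ⟩
      xn-1 K n 0 * s 0 x     ≈⟨ *-cong xn-1-at-0 (s-zero x) ⟩
      - 1# * x               ≈⟨ -1*x≈-x x ⟩
      - x                    ∎

  monicCoeff-at-k : ∀ {k} (a : Fin k → Carrier) → monicCoeff K k a k ≈ 1#
  monicCoeff-at-k {k} a with k ℕ.<? k | k ℕ.≟ k
  ... | yes p | _ = contradiction p (ℕ.<-irrefl ≡.refl)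
  ... | no _ | yes _ = refl
  ... | no _ | no p = contradiction ≡.refl p

  monicCoeff-above : ∀ {k} (a : Fin k → Carrier) → monicCoeff K k a ≺ suc k
  monicCoeff-above {k} a i k<i with i ℕ.<? k | i ℕ.≟ k
  ... | yes p | _ = contradiction p (ℕ.<-asym k<i)
  ... | no _ | yes ≡.refl = contradiction k<i (ℕ.<-irrefl ≡.refl)
  ... | no _ | no _ = refl

  monicCoeff-monic : ∀ {k} (a : Fin k → Carrier) → Monic k (monicCoeff K k a)
  monicCoeff-monic a = monicCoeff-at-k a , monicCoeff-above a

  monicCoeff-over : ∀ {k} (a : Fin k → Carrier) → (∀ i → Fq (a i)) → Over (monicCoeff K k a)
  monicCoeff-over {k} a fq i with i ℕ.<? k | i ℕ.≟ k
  ... | yes _ | _ = fq _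
  ... | no _ | yes _ = Fq-1#
  ... | no _ | no _ = Fq-0#

  monicCoeff-monic≋ : ∀ {k F} → Monic k F → monicCoeff K k (λ i → F (toℕ i)) ≋ F
  monicCoeff-monic≋ {k} {F} (f , f≺) i with i ℕ.<? k | i ℕ.≟ k
  ... | yes p | _ = reflexive (≡.cong F (Fin.toℕ-fromℕ< p))
  ... | no _ | yes ≡.refl = sym f
  ... | no i≮k | no i≢k = sym (f≺ i (ℕ.≤∧≢⇒< (ℕ.≮⇒≥ i≮k) λ e → i≢k (≡.sym e)))

  coeffList-≺ : ∀ g → coeffList K g ≺ length g
  coeffList-≺ [] i _ = refl
  coeffList-≺ (a ∷ g) (suc i) (ℕ.s≤s p) = coeffList-≺ g i p

  coeffList-over : ∀ {g} → All (InFq K q) g → Over (coeffList K g)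
  coeffList-over [] i = Fq-0#
  coeffList-over (f ∷ fs) zero = InFq⇒Fq f
  coeffList-over (f ∷ fs) (suc i) = coeffList-over fs i

  coeffList-applyUpTo : ∀ N {G} → G ≺ N → coeffList K (applyUpTo G N) ≋ G
  coeffList-applyUpTo zero g i = sym (g i ℕ.z≤n)
  coeffList-applyUpTo (suc N) g zero = refl
  coeffList-applyUpTo (suc N) g (suc i) = coeffList-applyUpTo N (λ j N≤j → g (suc j) (ℕ.s≤s N≤j)) i

  CyclicVector : ℕ → Set _
  CyclicVector k = ∃ λ x → moore K q k (conjugates K q k x) ≉0 × moore₁ K q k (conjugates K q k x) ≈ 0#

  FactorWithoutX : ℕ → Set _
  FactorWithoutX k = ∃ λ (a : Fin k → Carrier) → (∀ i → InFq K q (a i)) × (monicCoeff K k a 1 ≈ 0#)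
    × (∃ λ (g : List Carrier) → All (InFq K q) g
         × (∀ m → mulCoeff K (monicCoeff K k a) (coeffList K g) m ≈ xn-1 K n m))

  relation⇒factor : ∀ k {x F} → Independent k x → Over F → F ≺ suc k → F k ≉0 → F 1 ≈ 0# → F ⟨ k ⟩ x ≈ 0# → FactorWithoutX k
  relation⇒factor k {x} {F} ind F-over F≺ Fk≉0 F₁ Fx =
    let u , H-monic , H-over = normalise F-over F≺ Fk≉0
        H = λ i → u * F i
        G , G-over , G≺ , e = annihilator-divides k H-monic H-over ind
          (trans (act-scale (suc k) u F x) (trans (*-congˡ Fx) (zeroʳ u)))
          (suc n) xn-1-over (proj₂ xn-1-monic) (xn-1-kills x)
    in (λ i → H (toℕ i)) , (λ i → Fq⇒InFq (H-over (toℕ i))) ,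
       trans (monicCoeff-monic≋ H-monic 1) (trans (*-congˡ F₁) (zeroʳ u)) ,
       applyUpTo G (suc n) , applyUpTo⁺₂ G (suc n) (λ i → Fq⇒InFq (G-over i)) , λ i →
         trans (⊛-congʳ (coeffList K (applyUpTo G (suc n))) (monicCoeff-monic≋ H-monic) i)
           (trans (⊛-congˡ H (coeffList-applyUpTo (suc n) G≺) i) (sym (e i)))

  vector⇒factor : ∀ k → 2 ≤ k → CyclicVector k → FactorWithoutX k
  vector⇒factor k 2≤k (x , m≉0 , m₁≈0) =
    let f , f-over , (i , fi≉0) , fx = det≈0⇒dependent k _ (trans (sym (moore₁≈ k x)) m₁≈0)
        ind = moore≉0⇒independent m≉0
        F , F-over , F≺ , F₁ , F-at = spread 2≤k f f-over
        Fx = trans (act-rowExp₁ 2≤k F x F₁) (trans (∑-cong {k} λ i → *-congʳ (reflexive (F-at i))) fx)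
    in relation⇒factor k ind F-over F≺
         -- If F had no term of degree k, it would kill x with degree below k and hence be zero,
         -- contrary to its nonzero coefficient `f i`.
         (λ p → let F≺k = lower F≺ p in
           fi≉0 (trans (reflexive (≡.sym (F-at i)))
             (ind F F-over F≺k (trans (sym (act-≺ F≺k (ℕ.n≤1+n k) x)) Fx) _ ℕ.z≤n)))
         F₁ Fx
    where
    lower : ∀ {k F} → F ≺ suc k → F k ≈ 0# → F ≺ k
    lower F≺ p i k≤i with ℕ.m≤n⇒m<n∨m≡n k≤i
    ... | inj₁ k<i = F≺ i k<i
    ... | inj₂ ≡.refl = p

  moore-cong : ∀ k {x y} → x ≈ y → moore K q k (conjugates K q k x) ≈ moore K q k (conjugates K q k y)
  moore-cong k e = det-cong k λ i j → pow-cong (q ℕ.^ toℕ i) (pow-cong (q ℕ.^ toℕ j) e)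

  moore₁-cong : ∀ k {x y} → x ≈ y → moore₁ K q k (conjugates K q k x) ≈ moore₁ K q k (conjugates K q k y)
  moore₁-cong k e = det-cong k λ i j → pow-cong (q ℕ.^ rowExp₁ K i) (pow-cong (q ℕ.^ toℕ j) e)

  vector-stable : ∀ k → ¬ ¬ CyclicVector k → CyclicVector k
  vector-stable k ¬¬v with Fin.any? (λ i → ¬? (moore K q k (conjugates K q k (enum i)) ≟ 0#)
                                           ×-dec (moore₁ K q k (conjugates K q k (enum i)) ≟ 0#))
  ... | yes (i , p) = enum i , p
  ... | no none = contradiction
    (λ { (x , p , p₁) → none (index x , (λ e → p (trans (moore-cong k (sym (enum-index x))) e)) ,
                                trans (moore₁-cong k (enum-index x)) p₁) }) ¬¬v

  factor⇒vector : ∀ k → 2 ≤ k → FactorWithoutX k → CyclicVector k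
  factor⇒vector k 2≤k (a , a-over , F₁ , gs , gs-over , e) = vector-stable k λ none →
    vectorOfOrder k d k+d≡n F-monic F-over G-monic G-over FG λ where
      (y , ind) → none (G ⟨ d ⟩ y , independent⇒moore≉0 ind , trans (moore₁≈ k _)
        (dependent⇒det≈0 k _ ((λ i → F (rowExp₁ K i)) , (λ i → F-over (rowExp₁ K i)) ,
          (proj₁ (rowExp₁-last 2≤k) , λ p → 0≉1 (trans (sym p)
            (trans (reflexive (≡.cong F (proj₂ (rowExp₁-last 2≤k)))) (proj₁ F-monic)))) ,
          trans (sym (act-rowExp₁ 2≤k F _ F₁)) (FG y))))
    where
    F G : Seq
    F = monicCoeff K k a
    G = coeffList K gs
    F-monic : Monic k F
    F-monic = monicCoeff-monic a
    F-over : Over F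
    F-over = monicCoeff-over a (λ i → InFq⇒Fq (a-over i))
    G-over : Over G
    G-over = coeffList-over gs-over
    FG-monic : Monic n (F ⊛ G)
    FG-monic = monic-resp (λ i → sym (e i)) xn-1-monic
    -- Otherwise the product, of degree n < k, would force G = 0 and vanish, although it is monic.
    k≤n : k ≤ n
    k≤n with k ℕ.≤? n
    ... | yes p = p
    ... | no k≰n = contradiction
      (⊛-zeroʳ F (quotient-≺ {N = 0} F-monic
        (≺-mono (ℕ.≤-trans (ℕ.≰⇒> k≰n) (ℕ.m≤m+n k 0)) (proj₂ FG-monic)) (coeffList-≺ gs)))
      (monic≉0 FG-monic)
    d = proj₁ (ℕ.m≤n⇒∃[o]m+o≡n k≤n)
    k+d≡n : k ℕ.+ d ≡ n
    k+d≡n = proj₂ (ℕ.m≤n⇒∃[o]m+o≡n k≤n)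
    G-monic : Monic d G
    G-monic = quotient-monic F-monic (≡.subst (λ n → Monic n (F ⊛ G)) (≡.sym k+d≡n) FG-monic) (coeffList-≺ gs)
    FG : ∀ x → F ⟨ k ⟩ G ⟨ d ⟩ x ≈ 0#
    FG x = begin
      F ⟨ k ⟩ G ⟨ d ⟩ x          ≈⟨ act-comm (suc k) (suc d) F-over G-over x ⟩
      G ⟨ d ⟩ F ⟨ k ⟩ x          ≈⟨ ⟨⟩-⊛ F-monic G-monic F-over G-over x ⟨
      (F ⊛ G) ⟨ k ℕ.+ d ⟩ x      ≈⟨ reflexive (≡.cong (λ n → (F ⊛ G) ⟨ n ⟩ x) k+d≡n) ⟩
      (F ⊛ G) ⟨ n ⟩ x            ≈⟨ act-cong (suc n) e refl ⟩
      xn-1 K n ⟨ n ⟩ x           ≈⟨ xn-1-kills x ⟩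
      0#                         ∎

theorem4p12 : ∀ {c ℓ} (K : CommutativeRing c ℓ) → IsField K →
    (p e q k n : ℕ) → Prime p → q ≡ p ^ suc e → 2 ≤ k → 1 ≤ n →
    HasCard K (q ^ n) →
    let open CommutativeRing K in
    (∃ λ (x : Carrier) →
    ¬ (moore K q k (conjugates K q k x) ≈ 0#)
    × (moore₁ K q k (conjugates K q k x) ≈ 0#))
    ⇔
    (∃ λ (a : Fin k → Carrier) →
    (∀ i → InFq K q (a i))
    × (monicCoeff K k a 1 ≈ 0#)
    × (∃ λ (g : List Carrier) →
    All (InFq K q) g
    × (∀ m → mulCoeff K (monicCoeff K k a) (coeffList K g) m ≈ xn-1 K n m)))
theorem4p12 K isField p e q k n pr q≡ 2≤k 1≤n card =
  mk⇔ (vector⇒factor k 2≤k) (factor⇒vector k 2≤k)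
  where
  open CommutativeRing K using (_≈_; _+_)
  open FiniteFields K isField card using (module Frobenius)
  1<q : 1 ℕ.< q
  1<q = ≡.subst (1 ℕ.<_) (≡.sym q≡) (ℕ.≤-trans (ℕ.nonTrivial⇒n>1 p {{prime⇒nonTrivial pr}})
          (ℕ.m≤m*n p (p ^ e) {{ℕ.m^n≢0 p e {{ℕ.nonTrivial⇒nonZero p {{prime⇒nonTrivial pr}}}}}}))
  frobenius-+ : PowerAdditive K q
  -- K has q^n = p^((e+1)n) elements, hence characteristic p, and x ↦ x^q is the (e+1)-fold iterate
  -- of x ↦ x^p.
  frobenius-+ x y = ≡.subst (λ q → pow K (x + y) q ≈ pow K x q + pow K y q) (≡.sym q≡)
    (Frobenius.pow-+ p (suc e ℕ.* n) pr (≡.trans (≡.cong (_^ n) q≡) (ℕ.^-*-assoc p (suc e) n)) (suc e) x y)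
  open FrobeniusPolynomials K isField q n card 1<q 1≤n frobenius-+ using (vector⇒factor; factor⇒vector)
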